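{- Let $k\geq3$ and $n\geq3$. Then the conditional matching preclusion number of the DCell is $mp_1(D_{k,n})=2n+2k-5$. Moreover, $D_{k,n}$ is conditionally super matched for $k\geq4$ and $n\geq3$.
   Context: DCell $D_{k,n}$ ($n\geq 2$, $k\geq 0$) is defined recursively. $D_{0,n}$ is the complete graph $K_n$ on vertices $0,1,\dots,n-1$. Let $t_{k,n}=|V(D_{k,n})|$. For $k\geq1$, $D_{k,n}$ is built from $t_{k-1,n}+1$ disjoint copies $D^0_{k-1,n},\dots,D^{t_{k-1,n}}_{k-1,n}$ of $D_{k-1,n}$; a vertex of copy $D^i_{k-1,n}$ is labeled $(i,a_{k-1},\dots,a_0)$, where $(a_{k-1},\dots,a_0)$ is its label in $D_{k-1,n}$, and its index within the copy is $uid_{k-1}=a_0+\sum_{l=1}^{k-1}a_l t_{l-1,n}$. For each pair $a<b$ of copy indices, one edge joins the vertex of $D^a_{k-1,n}$ with $uid_{k-1}=b-1$ to the vertex of $D^b_{k-1,n}$ with $uid_{k-1}=a$. For a graph $G$ of even order, $mp_1(G)$ is the minimum number of edges whose deletion yields a graph with neither a perfect matching nor an isolated vertex. Let $v_e(G)=\min\{d_G(u)+d_G(w)-2-y_G(u,w)\}$ over all pairs $u,w$ that are the ends of a path $u v w$ of length $2$, where $y_G(u,w)=1$ if $uw\in E(G)$ and $0$ otherwise. A trivial optimal conditional solution is, for such a path $uvw$ attaining $v_e(G)$, the set of all edges incident to $u$ or $w$ other than $uv$ and $vw$. $G$ is conditionally super matched if $mp_1(G)=v_e(G)$ and every set of $mp_1(G)$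 edges whose deletion leaves a graph with no perfect matching and no isolated vertex is a trivial optimal conditional solution. -}

module Defs where

open import Data.Nat using (ℕ; zero; suc; _+_; _*_; _∸_; _≤_; _≡ᵇ_; _<ᵇ_)
open import Data.Fin using (Fin; toℕ; remQuot)
open import Data.Bool using (Bool; true; false; if_then_else_; not; _∧_; T)
open import Data.List using (List; length; map; allFin)
open import Data.Nat.ListAction using (sum)
open import Data.List.Membership.Propositional using (_∈_)
open import Data.List.Relation.Unary.All using (All)
open import Data.List.Relation.Unary.AllPairs using (AllPairs)
open import Data.Product using (Σ; _×_; _,_; proj₁; proj₂; ∃-syntax)
open import Data.Sum using (_⊎_)
open import Relation.Nullary using (¬_)
open import Relation.Binary.PropositionalEquality using (_≡_; _≢_)

record Graph : Set where
  field
    N   : ℕ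
    adj : Fin N → Fin N → Bool
open Graph public

t : ℕ → ℕ → ℕ
t zero    n = n
t (suc k) n = suc (t k n) * t k n

-- Vertex x of D_{k+1,n} (index in Fin (t (k+1) n)) corresponds to
-- (i , u) = remQuot x : copy index i and uid_k u, with x = i * t k n + u.
dcellAdj : (k n : ℕ) → Fin (t k n) → Fin (t k n) → Bool
dcellAdj zero    n x y = not (toℕ x ≡ᵇ toℕ y)
dcellAdj (suc k) n x y =
  let i = toℕ (proj₁ (remQuot {suc (t k n)} (t k n) x))
      u = proj₂ (remQuot {suc (t k n)} (t k n) x)
      j = toℕ (proj₁ (remQuot {suc (t k n)} (t k n) y))
      w = proj₂ (remQuot {suc (t k n)} (t k n) y)
  in if i ≡ᵇ j then dcellAdj k n u w
     else if i <ᵇ j then (toℕ u ≡ᵇ (j ∸ 1)) ∧ (toℕ w ≡ᵇ i)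
     else (toℕ w ≡ᵇ (i ∸ 1)) ∧ (toℕ u ≡ᵇ j)

DCell : ℕ → ℕ → Graph
DCell k n = record { N = t k n ; adj = dcellAdj k n }

module _ (G : Graph) where

  Edge : Fin (N G) → Fin (N G) → Set
  Edge u v = T (adj G u v)

  b2n : Bool → ℕ
  b2n true  = 1
  b2n false = 0

  deg : Fin (N G) → ℕ
  deg u = sum (map (λ y → b2n (adj G u y)) (allFin (N G)))

  -- a (finite) edge set: list of ordered pairs, read as unordered edges
  EdgeList : Set
  EdgeList = List (Fin (N G) × Fin (N G))

  SameEdge : Fin (N G) × Fin (N G) → Fin (N G) × Fin (N G) → Set
  SameEdge (a , b) (c , d) = (a ≡ c × b ≡ d) ⊎ (a ≡ d × b ≡ c)

  ValidEdgeSet : EdgeList → Set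
  ValidEdgeSet F = All (λ e → Edge (proj₁ e) (proj₂ e)) F
                 × AllPairs (λ e e′ → ¬ SameEdge e e′) F

  InF : EdgeList → Fin (N G) → Fin (N G) → Set
  InF F u v = (u , v) ∈ F ⊎ (v , u) ∈ F

  EdgeDel : EdgeList → Fin (N G) → Fin (N G) → Set
  EdgeDel F u v = Edge u v × ¬ InF F u v

  HasPerfectMatching : EdgeList → Set
  HasPerfectMatching F =
    Σ (Fin (N G) → Fin (N G)) λ M →
      (∀ x → M (M x) ≡ x) × (∀ x → M x ≢ x) × (∀ x → EdgeDel F x (M x))

  HasIsolatedVertex : EdgeList → Set
  HasIsolatedVertex F = ∃[ x ] (∀ y → ¬ EdgeDel F x y)

  CondSolution : EdgeList → Set
  CondSolution F = ¬ HasPerfectMatching F × ¬ HasIsolatedVertex F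

  IsMp1 : ℕ → Set
  IsMp1 m = (∃[ F ] (ValidEdgeSet F × length F ≡ m × CondSolution F))
          × (∀ F → ValidEdgeSet F → CondSolution F → m ≤ length F)

  Path2 : Fin (N G) → Fin (N G) → Fin (N G) → Set
  Path2 u v w = Edge u v × Edge v w × u ≢ w

  veVal : Fin (N G) → Fin (N G) → ℕ
  veVal u w = deg u + deg w ∸ 2 ∸ b2n (adj G u w)

  IsVe : ℕ → Set
  IsVe m = (∃[ u ] ∃[ v ] ∃[ w ] (Path2 u v w × veVal u w ≡ m))
         × (∀ u v w → Path2 u v w → m ≤ veVal u w)

  TrivialSolution : ℕ → EdgeList → Set
  TrivialSolution m F =
    ∃[ u ] ∃[ v ] ∃[ w ] (Path2 u v w × veVal u w ≡ m ×
      (∀ a b → (InF F a b →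
                  Edge a b × (a ≡ u ⊎ a ≡ w ⊎ b ≡ u ⊎ b ≡ w)
                  × ¬ SameEdge (a , b) (u , v) × ¬ SameEdge (a , b) (v , w))
             × (Edge a b × (a ≡ u ⊎ a ≡ w ⊎ b ≡ u ⊎ b ≡ w)
                  × ¬ SameEdge (a , b) (u , v) × ¬ SameEdge (a , b) (v , w)
                → InF F a b)))

  ConditionallySuperMatched : Set
  ConditionallySuperMatched =
    Σ ℕ λ m → IsMp1 m × IsVe m ×
      (∀ F → ValidEdgeSet F → length F ≡ m → CondSolution F → TrivialSolution m F)

-- Let F leave neither a perfect matching nor an isolated vertex, and let r = n - 1 + k be the degree.
-- As the order is even, Tutte–Berge gives a set S whose removal from G - F leaves at least |S| + 2 odd
-- components (obtained from a maximal S of deficiency two, by Gallai's lemma and Schrijver's exchange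
-- argument; every component is then odd). Counting in G the edges that leave the components gives
--   Σ ∂C + 2 e(S) ≤ r |S| + 2 |F|.
-- Every ∂C is at least r, and at least 3r - 6 as soon as C and its complement have three vertices. One
-- component of that kind yields |F| ≥ 2r - 3. If all components are singletons, S has almost half of the
-- vertices, and the partition of G into cliques K_n makes e(S) too large.
-- For k ≥ 4 the bound 3r - 6 is improved to 3r - 5 when C and its complement have four vertices; then
-- |F| = 2r - 3 forces |S| = 1 and two singleton components, i.e. the trivial solution around a triangle.
module Submission where

open import Defs
open import Data.Nat as ℕ using (ℕ; zero; suc; _+_; _*_; _∸_; _≤_; _<_; z≤n; s≤s; _<ᵇ_; _≡ᵇ_)
open import Data.Nat.Properties hiding (_≟_)
open import Data.Nat.Tactic.RingSolver using (solve; solve-∀)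
open import Algebra.Properties.Semiring.Sum +-*-semiring using (*-distribˡ-sum)
open import Data.Bool as Bool using (Bool; true; false; not; _∧_; _∨_; T; if_then_else_)
open import Data.Bool.Properties using (T?; ¬-not; ∧-comm; ∧-zeroʳ; ∨-comm; ∨-zeroʳ)
import Algebra.Properties.CommutativeMonoid.Sum +-0-commutativeMonoid as Σℕ
open import Data.Fin using (Fin; zero; suc; toℕ; _≟_; combine; remQuot; punchIn; punchOut; _↑ˡ_; _↑ʳ_)
open import Data.Fin.Properties
  using (any?; all?; toℕ-injective; remQuot-combine; combine-remQuot; punchInᵢ≢i; punchIn-punchOut)
open import Data.Fin.Permutation using (permutation)
open import Data.List using (List; []; _∷_; length; map; allFin; tabulate; _++_; filter)
open import Data.List.Membership.Propositional using (_∈_)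
open import Data.List.Membership.Propositional.Properties
  using (∈-map⁺; ∈-map⁻; ∈-++⁺ˡ; ∈-++⁺ʳ; ∈-++⁻; ∈-filter⁺; ∈-filter⁻; ∈-allFin)
open import Data.List.Properties using (length-++; length-map)
import Data.List.Relation.Unary.All as All
open import Data.List.Relation.Unary.AllPairs as Pairs using (AllPairs)
import Data.List.Relation.Unary.AllPairs.Properties as AllPairs
open import Data.List.Relation.Unary.Any using (here; there)
import Data.List.Relation.Unary.Unique.Propositional.Properties as Unique
open import Data.Nat.ListAction using () renaming (sum to listSum)
open import Data.Product using (_×_; _,_; proj₁; proj₂; ∃-syntax)
open import Data.Sum as Sum using (_⊎_; inj₁; inj₂; [_,_]′)
open import Data.Empty using (⊥; ⊥-elim)
open import Data.Unit using (tt)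
open import Function using (_∘_; case_of_)
open import Relation.Nullary using (¬_; Dec; yes; no; contradiction)
open import Relation.Nullary.Decidable using (⌊_⌋; _×-dec_; _→-dec_; ¬?; decidable-stable)
open import Relation.Binary.PropositionalEquality as ≡
  using (_≡_; _≢_; refl; sym; trans; cong; cong₂; subst)
open import Relation.Binary.Definitions using (tri<; tri≈; tri>)

-- The thresholds for k come from the cliques: K_n has boundary nk, and nk - (3r - 6) = (n - 3)(k -
-- 3). So for n > 3 the bound 3r - 6 is exact for K_n at k = 3, and 3r - 5 fails there, for instance
-- for K_4 in D_{3,4}. The boundary bounds do not pass directly through the recursion, because a set
-- may fill whole copies. For a set inside one copy, the induction carries the edges of all higher
-- levels as a weight on its vertices. For a set spread over several copies, full copies are removed
-- by passing to the complement; when there is an empty copy as well, the boundary is already as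
-- large as a copy. Goodness of S and the relation whose classes serve as components quantify over
-- all matchings and are never decided. The barrier is therefore obtained only under a double
-- negation. This is enough, because the two conclusions drawn from it are decidable: the inequality
-- for |F|, and the existence of two vertices whose only remaining neighbour is the same vertex.

private variable
  m n : ℕ

-- Indicators, finite sums and cardinalities.

𝟙 : Bool → ℕ
𝟙 true  = 1
𝟙 false = 0

infix 7 _==_
_==_ : Fin n → Fin n → Bool
x == y = ⌊ x ≟ y ⌋

==-refl : (x : Fin n) → (x == x) ≡ true
==-refl x with x ≟ x
... | yes _   = refl
... | no x≢x = contradiction refl x≢x

==-≢ : {x y : Fin n} → x ≢ y → (x == y) ≡ false
==-≢ {x = x} {y} x≢y with x ≟ y
... | yes x≡y = contradiction x≡y x≢y
... | no _    = refl

==⇒≡ : {x y : Fin n} → (x == y) ≡ true → x ≡ y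
==⇒≡ {x = x} {y} e with x ≟ y
... | yes x≡y = x≡y

==-sym : (x y : Fin n) → (x == y) ≡ (y == x)
==-sym x y with x ≟ y | y ≟ x
... | yes _   | yes _   = refl
... | no _    | no _    = refl
... | yes x≡y | no y≢x  = contradiction (sym x≡y) y≢x
... | no x≢y  | yes y≡x = contradiction (sym y≡x) x≢y

bool : (b : Bool) → b ≡ true ⊎ b ≡ false
bool true  = inj₁ refl
bool false = inj₂ refl

true≢false : true ≢ false
true≢false ()

T⇒≡ : {b : Bool} → T b → b ≡ true
T⇒≡ {true} _ = refl

≡⇒T : {b : Bool} → b ≡ true → T b
≡⇒T refl = tt

∧-split : {a b : Bool} → (a ∧ b) ≡ true → a ≡ true × b ≡ true
∧-split {true} {true} _ = refl , refl

𝟙≤1 : (b : Bool) → 𝟙 b ≤ 1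
𝟙≤1 true  = ≤-refl
𝟙≤1 false = z≤n

1≤𝟙⇒ : {b : Bool} → 1 ≤ 𝟙 b → b ≡ true
1≤𝟙⇒ {true} _ = refl

-- A linear inequality l ≤ r follows from the sum X ≤ Y of its hypotheses once r − l = (Y − X) + c.
linear : ∀ {X Y} c {l r} → X ≤ Y → l + Y + c ≡ r + X → l ≤ r
linear {X} {Y} c {l} {r} X≤Y e = +-cancelʳ-≤ X l r (begin
  l + X     ≤⟨ +-monoʳ-≤ l X≤Y ⟩
  l + Y     ≤⟨ m≤m+n (l + Y) c ⟩
  l + Y + c ≡⟨ e ⟩
  r + X     ∎)
  where open ≤-Reasoning

-- Opaque, so that unification can read f off sum f.
opaque
  sum : (Fin n → ℕ) → ℕ
  sum = Σℕ.sum

opaque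
  unfolding sum

  sum-cong : {f g : Fin n → ℕ} → (∀ i → f i ≡ g i) → sum f ≡ sum g
  sum-cong = Σℕ.sum-cong-≗

  sum-+ : (f g : Fin n → ℕ) → sum (λ i → f i + g i) ≡ sum f + sum g
  sum-+ = Σℕ.∑-distrib-+

  sum-* : (c : ℕ) (f : Fin n → ℕ) → sum (λ i → c * f i) ≡ c * sum f
  sum-* c f = sym (*-distribˡ-sum c f)

  sum-swap : (f : Fin m → Fin n → ℕ) → sum (λ i → sum (f i)) ≡ sum (λ j → sum (λ i → f i j))
  sum-swap = Σℕ.∑-comm

  sum-remove : (i : Fin (suc n)) (f : Fin (suc n) → ℕ) → sum f ≡ f i + sum (λ j → f (punchIn i j))
  sum-remove i f = Σℕ.sum-remove {i = i} f

  sum-involution : (π : Fin n → Fin n) → (∀ i → π (π i) ≡ i) → (f : Fin n → ℕ) → sum f ≡ sum (f ∘ π)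
  sum-involution π ππ f = Σℕ.sum-permute f (permutation π π ππ ππ)

  sum-zero : {f : Fin n → ℕ} → (∀ i → f i ≡ 0) → sum f ≡ 0
  sum-zero {n} f≡0 = trans (sum-cong f≡0) (Σℕ.sum-replicate-zero n)

  sum-mono : {f g : Fin n → ℕ} → (∀ i → f i ≤ g i) → sum f ≤ sum g
  sum-mono {zero}  _   = z≤n
  sum-mono {suc n} f≤g = +-mono-≤ (f≤g zero) (sum-mono (f≤g ∘ suc))

  sum-mono-tight : {f g : Fin n → ℕ} → (∀ i → f i ≤ g i) → sum g ≤ sum f → ∀ i → g i ≤ f i
  sum-mono-tight {f = f} {g} f≤g Σg≤Σf zero =
    +-cancelʳ-≤ (sum (g ∘ suc)) _ _ (≤-trans Σg≤Σf (+-monoʳ-≤ (f zero) (sum-mono (f≤g ∘ suc))))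
  sum-mono-tight {f = f} {g} f≤g Σg≤Σf (suc i) =
    sum-mono-tight (f≤g ∘ suc)
      (+-cancelˡ-≤ (g zero) _ _ (≤-trans Σg≤Σf (+-monoˡ-≤ (sum (f ∘ suc)) (f≤g zero)))) i

  sum-const : (c : ℕ) → sum {n} (λ _ → c) ≡ n * c
  sum-const {n = zero}  c = refl
  sum-const {n = suc n} c = cong (c +_) (sum-const {n = n} c)

  term≤sum : (f : Fin n → ℕ) (i : Fin n) → f i ≤ sum f
  term≤sum f zero    = m≤m+n _ _
  term≤sum f (suc i) = ≤-trans (term≤sum (f ∘ suc) i) (m≤n+m _ (f zero))

  terms₂≤sum : (f : Fin n → ℕ) {i j : Fin n} → i ≢ j → f i + f j ≤ sum f
  terms₂≤sum f {zero}  {zero}  i≢j = contradiction refl i≢j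
  terms₂≤sum f {zero}  {suc j} i≢j = +-monoʳ-≤ (f zero) (term≤sum (f ∘ suc) j)
  terms₂≤sum f {suc i} {zero}  i≢j = ≤-trans (≤-reflexive (+-comm (f (suc i)) (f zero))) (+-monoʳ-≤ (f zero) (term≤sum (f ∘ suc) i))
  terms₂≤sum f {suc i} {suc j} i≢j = ≤-trans (terms₂≤sum (f ∘ suc) (i≢j ∘ cong suc)) (m≤n+m _ (f zero))

  positive-term : {f : Fin n → ℕ} → 1 ≤ sum f → ∃[ i ] 1 ≤ f i
  positive-term {suc n} {f} p with f zero in eq
  ... | suc _ = zero , ≤-trans (s≤s z≤n) (≤-reflexive (sym eq))
  ... | zero  = let i , q = positive-term {f = f ∘ suc} p in suc i , q

  sum-++ : (f : Fin (m + n) → ℕ) → sum f ≡ sum (λ i → f (i ↑ˡ n)) + sum (λ j → f (m ↑ʳ j))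
  sum-++ {zero}  f = refl
  sum-++ {suc m} f = trans (cong (f zero +_) (sum-++ {m} (f ∘ suc))) (sym (+-assoc (f zero) _ _))

  sum-combine : (f : Fin (m * n) → ℕ) → sum f ≡ sum (λ i → sum (λ j → f (combine {m} i j)))
  sum-combine {zero}      f = refl
  sum-combine {suc m} {n} f = trans (sum-++ {n} f) (cong (sum (λ j → f (j ↑ˡ (m * n))) +_) (sum-combine {m} (λ x → f (n ↑ʳ x))))

sum-single : (i : Fin n) (f : Fin n → ℕ) → sum (λ j → 𝟙 (j == i) * f j) ≡ f i
sum-single {suc n} i f = trans (sum-remove i g) (trans (cong₂ _+_ at-i (sum-zero off-i)) (+-identityʳ (f i)))
  where
  g : Fin (suc n) → ℕ
  g j = 𝟙 (j == i) * f j
  at-i : g i ≡ f i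
  at-i rewrite ==-refl i = +-identityʳ (f i)
  off-i : ∀ j → g (punchIn i j) ≡ 0
  off-i j rewrite ==-≢ (punchInᵢ≢i i j) = refl

sum-indicator : (i : Fin n) → sum (λ j → 𝟙 (j == i)) ≡ 1
sum-indicator i = trans (sum-cong (λ j → sym (*-identityʳ (𝟙 (j == i))))) (sum-single i (λ _ → 1))

terms₃≤sum : (f : Fin n → ℕ) {i j k : Fin n} → i ≢ j → i ≢ k → j ≢ k → f i + f j + f k ≤ sum f
terms₃≤sum {n} f {i} {j} {k} i≢j i≢k j≢k = begin
  f i + f j + f k                      ≡⟨ cong₂ _+_ (cong₂ _+_ (eq i) (eq j)) (eq k) ⟩
  sum (e i) + sum (e j) + sum (e k)     ≡⟨ cong (_+ sum (e k)) (sym (sum-+ (e i) (e j))) ⟩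
  sum (λ x → e i x + e j x) + sum (e k) ≡⟨ sym (sum-+ (λ x → e i x + e j x) (e k)) ⟩
  sum (λ x → e i x + e j x + e k x)     ≤⟨ sum-mono bound ⟩
  sum f                                 ∎
  where
  open ≤-Reasoning
  e : Fin n → Fin n → ℕ
  e i x = 𝟙 (x == i) * f x
  eq : ∀ i → f i ≡ sum (e i)
  eq i = sym (sum-single i f)
  bound : ∀ x → e i x + e j x + e k x ≤ f x
  bound x with x ≟ i | x ≟ j | x ≟ k
  ... | yes p | yes q | _     = contradiction (trans (sym p) q) i≢j
  ... | yes p | no _  | yes q = contradiction (trans (sym p) q) i≢k
  ... | no _  | yes p | yes q = contradiction (trans (sym p) q) j≢k
  ... | yes _ | no _  | no _  = ≤-reflexive (solve-∀′ (f x))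
    where solve-∀′ : ∀ a → 1 * a + 0 + 0 ≡ a
          solve-∀′ = solve-∀
  ... | no _  | yes _ | no _  = ≤-reflexive (solve-∀′ (f x))
    where solve-∀′ : ∀ a → 0 + 1 * a + 0 ≡ a
          solve-∀′ = solve-∀
  ... | no _  | no _  | yes _ = ≤-reflexive (+-identityʳ (f x))
  ... | no _  | no _  | no _  = z≤n

sum-without : (f : Fin n → ℕ) (i : Fin n) → sum f ≡ f i + sum (λ j → 𝟙 (not (j == i)) * f j)
sum-without f i = trans (sum-cong split) (trans (sum-+ _ _) (cong (_+ sum (λ j → 𝟙 (not (j == i)) * f j)) (sum-single i f)))
  where
  split : ∀ j → f j ≡ 𝟙 (j == i) * f j + 𝟙 (not (j == i)) * f j
  split j with j == i
  ... | true  = sym (trans (+-identityʳ _) (+-identityʳ _))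
  ... | false = sym (+-identityʳ _)

another-term : {f : Fin n → ℕ} (i : Fin n) → f i < sum f → ∃[ j ] j ≢ i × 1 ≤ f j
another-term {f = f} i p with positive-term (+-cancelˡ-≤ (f i) 1 _
  (≤-trans (≤-reflexive (+-comm (f i) 1)) (≤-trans p (≤-reflexive (sum-without f i)))))
... | j , q with j ≟ i
... | no j≢i = j , j≢i , ≤-trans q (≤-reflexive (+-identityʳ (f j)))

card : (Fin n → Bool) → ℕ
card P = sum (λ x → 𝟙 (P x))

card≤ : (P : Fin n → Bool) → card P ≤ n
card≤ {n} P = ≤-trans (sum-mono (λ i → 𝟙≤1 (P i))) (≤-reflexive (trans (sum-const {n} 1) (*-identityʳ n)))

card-complement : (P : Fin n → Bool) → card P + card (not ∘ P) ≡ n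
card-complement {n} P = trans (sym (sum-+ _ _)) (trans (sum-cong one) (trans (sum-const {n} 1) (*-identityʳ n)))
  where
  one : ∀ i → 𝟙 (P i) + 𝟙 (not (P i)) ≡ 1
  one i with P i
  ... | true  = refl
  ... | false = refl

card-delete : (P : Fin n → Bool) {v : Fin n} → P v ≡ true → suc (card (λ x → P x ∧ not (x == v))) ≡ card P
card-delete P {v} v∈P = trans (+-comm 1 _) (trans (cong (card (λ x → P x ∧ not (x == v)) +_) (sym (sum-indicator v)))
  (trans (sym (sum-+ _ _)) (sum-cong split)))
  where
  split : ∀ x → 𝟙 (P x ∧ not (x == v)) + 𝟙 (x == v) ≡ 𝟙 (P x)
  split x with x ≟ v
  ... | yes refl rewrite v∈P = refl
  ... | no _ with P x
  ...   | true  = refl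
  ...   | false = refl

-- Double negation commutes with finite conjunctions. This allows a relation to be assumed decidable
-- on all pairs of vertices at once.
¬¬-∀ : {P : Fin n → Set} → (∀ i → ¬ ¬ P i) → ¬ ¬ (∀ i → P i)
¬¬-∀ {zero}  _ k = k λ ()
¬¬-∀ {suc n} p k = p zero λ p₀ → ¬¬-∀ (p ∘ suc) λ ps → k λ { zero → p₀ ; (suc i) → ps i }

¬¬-dec : {P : Set} → ¬ ¬ Dec P
¬¬-dec k = k (no (k ∘ yes))

-- `M` exchanges the elements of `P` below their image with those above it, so whatever is not fixed
-- pairs off; `j` counts the pairs.
involution-parity : (M : Fin n → Fin n) → (∀ x → M (M x) ≡ x) →
  (P : Fin n → Bool) → (∀ x → P (M x) ≡ P x) →
  ∃[ j ] card P ≡ card (λ x → P x ∧ M x == x) + 2 * j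
involution-parity {n} M MM P PM = card up , (begin
  card P                                        ≡⟨ sum-cong split ⟩
  sum (λ x → 𝟙 (fixed x) + (𝟙 (up x) + 𝟙 (down x))) ≡⟨ sum-+ _ _ ⟩
  card fixed + sum (λ x → 𝟙 (up x) + 𝟙 (down x))    ≡⟨ cong (card fixed +_) (sum-+ _ _) ⟩
  card fixed + (card up + card down)             ≡⟨ cong (λ a → card fixed + (card up + a)) down≡up ⟩
  card fixed + (card up + card up)               ≡⟨ cong (λ a → card fixed + (card up + a)) (sym (+-identityʳ _)) ⟩
  card fixed + 2 * card up                       ∎)
  where
  open ≡.≡-Reasoning
  fixed up down : Fin n → Bool
  fixed x = P x ∧ M x == x
  up x    = P x ∧ ⌊ toℕ x <? toℕ (M x) ⌋
  down x  = P x ∧ ⌊ toℕ (M x) <? toℕ x ⌋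
  split : ∀ x → 𝟙 (P x) ≡ 𝟙 (fixed x) + (𝟙 (up x) + 𝟙 (down x))
  split x with P x | M x ≟ x | toℕ x <? toℕ (M x) | toℕ (M x) <? toℕ x
  ... | false | _ | _ | _ = refl
  ... | true | yes e | yes l | _ = contradiction (sym (cong toℕ e)) (<⇒≢ l)
  ... | true | yes e | no _ | yes l = contradiction (cong toℕ e) (<⇒≢ l)
  ... | true | yes _ | no _ | no _ = refl
  ... | true | no _ | yes l | yes l′ = contradiction l (<-asym l′)
  ... | true | no _ | yes _ | no _ = refl
  ... | true | no _ | no _ | yes _ = refl
  ... | true | no ne | no p | no q = contradiction (toℕ-injective (≤-antisym (≮⇒≥ p) (≮⇒≥ q))) ne
  down≡up : card down ≡ card up
  down≡up = trans (sum-involution M MM (𝟙 ∘ down)) (sum-cong λ x →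
    cong 𝟙 (cong₂ (λ a b → a ∧ ⌊ toℕ b <? toℕ (M x) ⌋) (PM x) (MM x)))

insert : (Fin n → Bool) → Fin n → Fin n → Bool
insert S x y = S y ∨ y == x

card-insert : (S : Fin n → Bool) {x : Fin n} → S x ≡ false → card (insert S x) ≡ suc (card S)
card-insert S {x} x∉S = trans (sum-cong split) (trans (sum-+ _ _) (trans (cong (card S +_) (sum-indicator x)) (+-comm _ 1)))
  where
  split : ∀ y → 𝟙 (insert S x y) ≡ 𝟙 (S y) + 𝟙 (y == x)
  split y with S y in y∈S | y ≟ x
  ... | true  | yes refl = contradiction (trans (sym y∈S) x∉S) true≢false
  ... | true  | no _     = refl
  ... | false | _        = refl

-- Matchings and the Tutte-Berge barrier.

module _ {N : ℕ} (H : Fin N → Fin N → Bool) where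

  -- A matching is encoded as an involution whose fixed points are the missed vertices.
  record Matching (M : Fin N → Fin N) : Set where
    field
      involutive : ∀ x → M (M x) ≡ x
      edge       : ∀ x → M x ≢ x → H x (M x) ≡ true
  open Matching

  missed : (Fin N → Fin N) → ℕ
  missed M = card (λ x → M x == x)

  -- A Tutte set S whose odd components outnumber it by two, with the odd components given by their
  -- representatives ρ x; the graph without S has no even components.
  record Barrier : Set where
    field
      S      : Fin N → Bool
      ρ      : Fin N → Fin N
      ρ∉S    : ∀ x → S x ≡ false → S (ρ x) ≡ false
      ρ-idem : ∀ x → S x ≡ false → ρ (ρ x) ≡ ρ x
      closed : ∀ x y → S x ≡ false → S y ≡ false → H x y ≡ true → ρ x ≡ ρ y
    root : Fin N → Bool
    root x = not (S x) ∧ ρ x == x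
    class : Fin N → Fin N → Bool
    class u x = not (S x) ∧ ρ x == u
    field
      odd   : ∀ u → root u ≡ true → ∃[ j ] card (class u) ≡ 1 + 2 * j
      roots : card root ≡ 2 + card S

  module Tutte (H-sym : ∀ x y → H x y ≡ true → H y x ≡ true) (h : ℕ) (even : N ≡ 2 * h) where

    Fixes : (Fin N → Bool) → (Fin N → Fin N) → Set
    Fixes S M = ∀ x → S x ≡ true → M x ≡ x

    -- A matching that fixes `S` is a matching of the graph without `S`. The vertices of `S` count
    -- as missed, so at least `2 + card S` vertices outside `S` are missed as well.
    Good : (Fin N → Bool) → Set
    Good S = ∀ M → Matching M → Fixes S M → 2 + 2 * card S ≤ missed M

    -- Whether some insertion keeps `S` good is not decidable here, hence the double negation; `f`
    -- bounds the number of vertices still available for insertion.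
    maximal-good : (f : ℕ) (S : Fin N → Bool) → N ≤ card S + f → Good S →
      ¬ ¬ (∃[ S′ ] Good S′ × (∀ x → S′ x ≡ false → ¬ Good (insert S′ x)))
    maximal-good zero S full good k = k (S , good , λ x x∉S _ →
      <-irrefl refl (≤-trans (s≤s full) (≤-trans (≤-reflexive (trans (cong suc (+-identityʳ _)) (sym (card-insert S x∉S)))) (card≤ (insert S x)))))
    maximal-good (suc f) S N≤ good k = k (S , good , λ x x∉S good′ →
      maximal-good f (insert S x) (≤-trans N≤ (≤-reflexive (trans (+-suc _ f) (cong (_+ f) (sym (card-insert S x∉S)))))) good′ k)

    missed-even : ∀ M → Matching M → ∃[ j ] 2 * h ≡ missed M + 2 * j
    missed-even M match with involution-parity M (involutive match) (λ _ → true) (λ _ → refl)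
    ... | j , e = j , trans (sym even) (trans (sym (trans (sum-const 1) (*-identityʳ N))) e)

    -- Meant for `x` missed by `M`: the edge from `x` to `y` enters the matching and the former
    -- partner of `y` is released. If `y` is missed too, this is an augmentation; otherwise the
    -- number of missed vertices does not change.
    relink : Fin N → Fin N → (Fin N → Fin N) → Fin N → Fin N
    relink x y M v = if v == x then y else if v == y then x else if v == M y then v else M v

    data View (x y : Fin N) (M : Fin N → Fin N) (v : Fin N) : Set where
      at-x    : v ≡ x → relink x y M v ≡ y → View x y M v
      at-y    : v ≢ x → v ≡ y → relink x y M v ≡ x → View x y M v
      at-My   : v ≢ x → v ≢ y → v ≡ M y → relink x y M v ≡ v → View x y M v
      at-rest : v ≢ x → v ≢ y → v ≢ M y → relink x y M v ≡ M v → View x y M v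

    view : ∀ x y M v → View x y M v
    view x y M v with v ≟ x in p | v ≟ y in q | v ≟ M y in r
    ... | yes e | _ | _ = at-x e (value p)
      where value : (v ≟ x) ≡ yes e → relink x y M v ≡ y
            value p rewrite p = refl
    ... | no e | yes e′ | _ = at-y e e′ (value p q)
      where value : (v ≟ x) ≡ no e → (v ≟ y) ≡ yes e′ → relink x y M v ≡ x
            value p q rewrite p | q = refl
    ... | no e | no e′ | yes e″ = at-My e e′ e″ (value p q r)
      where value : (v ≟ x) ≡ no e → (v ≟ y) ≡ no e′ → (v ≟ M y) ≡ yes e″ → relink x y M v ≡ v
            value p q r rewrite p | q | r = refl
    ... | no e | no e′ | no e″ = at-rest e e′ e″ (value p q r)
      where value : (v ≟ x) ≡ no e → (v ≟ y) ≡ no e′ → (v ≟ M y) ≡ no e″ → relink x y M v ≡ M v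
            value p q r rewrite p | q | r = refl

    relink-fix : ∀ {x y M v} → v ≢ x → v ≢ y → M v ≡ v → relink x y M v ≡ v
    relink-fix {x} {y} {M} {v} v≢x v≢y Mv with view x y M v
    ... | at-x e _ = contradiction e v≢x
    ... | at-y _ e _ = contradiction e v≢y
    ... | at-My _ _ _ e = e
    ... | at-rest _ _ _ e = trans e Mv

    relink-matching : ∀ {x y M} → Matching M → M x ≡ x → x ≢ y → H x y ≡ true → Matching (relink x y M)
    relink-matching {x} {y} {M} match Mx x≢y xy = record { involutive = inv ; edge = edg }
      where
      MM = involutive match
      L = relink x y M
      Lx : L x ≡ y
      Lx with view x y M x
      ... | at-x _ e = e
      ... | at-y ne _ _ = contradiction refl ne
      ... | at-My ne _ _ _ = contradiction refl ne
      ... | at-rest ne _ _ _ = contradiction refl ne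
      Ly : L y ≡ x
      Ly with view x y M y
      ... | at-x e _ = contradiction (sym e) x≢y
      ... | at-y _ _ e = e
      ... | at-My _ ne _ _ = contradiction refl ne
      ... | at-rest _ ne _ _ = contradiction refl ne
      inv : ∀ v → L (L v) ≡ v
      inv v with view x y M v
      ... | at-x refl e = trans (cong L e) Ly
      ... | at-y _ refl e = trans (cong L e) Lx
      ... | at-My _ _ _ e = trans (cong L e) e
      ... | at-rest v≢x v≢y v≢My e with view x y M (M v)
      ...   | at-x p _ = contradiction (trans (sym (MM v)) (trans (cong M p) Mx)) v≢x
      ...   | at-y _ p _ = contradiction (trans (sym (MM v)) (cong M p)) v≢My
      ...   | at-My _ _ p _ = contradiction (trans (sym (MM v)) (trans (cong M p) (MM y))) v≢y
      ...   | at-rest _ _ _ p = trans (cong L e) (trans p (MM v))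
      edg : ∀ v → L v ≢ v → H v (L v) ≡ true
      edg v Lv≢v with view x y M v
      ... | at-x refl e = trans (cong (H x) e) xy
      ... | at-y _ refl e = trans (cong (H y) e) (H-sym x y xy)
      ... | at-My _ _ _ e = contradiction e Lv≢v
      ... | at-rest _ _ _ e = trans (cong (H v) e) (edge match v (λ p → Lv≢v (trans e p)))

    module Maximal (S : Fin N → Bool) (good : Good S) (maximal : ∀ x → S x ≡ false → ¬ Good (insert S x)) where

      record Tight (M : Fin N → Fin N) : Set where
        field
          matching : Matching M
          fixes    : Fixes S M
          deficit  : missed M ≡ 2 + 2 * card S
      open Tight

      -- By maximality some matching fixing `S` and `x` misses fewer than `4 + 2 * card S` vertices.
      -- Goodness of `S` gives at least `2 + 2 * card S`, and `3 + 2 * card S` has the wrong parity.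
      -- Every vertex outside `S` is thus missed by a tight matching, which is the hypothesis of
      -- Gallai's lemma.
      tight-missing : ∀ x → S x ≡ false → ¬ ¬ (∃[ M ] Tight M × M x ≡ x)
      tight-missing x x∉S k = maximal x x∉S λ M match fix → squeeze M match fix (missed-even M match)
        where
        in-S : ∀ M → Fixes (insert S x) M → Fixes S M
        in-S M fix y y∈S = fix y (cong (_∨ y == x) y∈S)
        misses-x : ∀ M → Fixes (insert S x) M → M x ≡ x
        misses-x M fix = fix x (trans (cong (_∨ x == x) x∉S) (==-refl x))
        squeeze : ∀ M → Matching M → Fixes (insert S x) M → ∃[ j ] 2 * h ≡ missed M + 2 * j →
          2 + 2 * card (insert S x) ≤ missed M
        squeeze M match fix (j , e) with 4 + 2 * card S ≤? missed M | 3 + 2 * card S ≤? missed M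
        ... | yes p | _ = ≤-trans (≤-reflexive (trans (cong (λ c → 2 + 2 * c) (card-insert S x∉S)) (cong (2 +_) (*-suc 2 (card S))))) p
        ... | no p | yes q = contradiction (trans e (trans (cong (_+ 2 * j) (≤-antisym (≤-pred (≰⇒> p)) q)) (odd-sum (card S) j))) (even≢odd h (1 + card S + j))
          where odd-sum : ∀ s j → 3 + 2 * s + 2 * j ≡ suc (2 * (1 + s + j))
                odd-sum = solve-∀
        ... | no _ | no q = ⊥-elim (k (M , record { matching = match ; fixes = in-S M fix ; deficit = ≤-antisym (≤-pred (≰⇒> q)) (good M match (in-S M fix)) } , misses-x M fix))

      relink-fixes : ∀ {x y M} → S x ≡ false → S y ≡ false → Fixes S M → Fixes S (relink x y M)
      relink-fixes {x} {y} x∉S y∉S fix v v∈S = relink-fix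
        (λ { refl → true≢false (trans (sym v∈S) x∉S) }) (λ { refl → true≢false (trans (sym v∈S) y∉S) }) (fix v v∈S)

      no-augmentation : ∀ {M} → Tight M → ∀ {x y} → S x ≡ false → S y ≡ false → x ≢ y → H x y ≡ true →
        M x ≡ x → M y ≡ y → ⊥
      no-augmentation {M} tight {x} {y} x∉S y∉S x≢y xy Mx My = <-irrefl refl (begin-strict
        missed L              <⟨ n<1+n _ ⟩
        1 + missed L          ≤⟨ m≤n+m _ 1 ⟩
        1 + (1 + missed L)    ≡⟨ cong₂ _+_ (sum-indicator x) (cong (_+ missed L) (sum-indicator y)) ⟨
        card (_== x) + (card (_== y) + missed L) ≡⟨ cong (card (_== x) +_) (sum-+ _ _) ⟨
        card (_== x) + sum (λ v → 𝟙 (v == y) + 𝟙 (L v == v)) ≡⟨ sum-+ _ _ ⟨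
        sum (λ v → 𝟙 (v == x) + (𝟙 (v == y) + 𝟙 (L v == v))) ≤⟨ sum-mono fewer ⟩
        missed M              ≡⟨ deficit tight ⟩
        2 + 2 * card S        ≤⟨ good L (relink-matching (matching tight) Mx x≢y xy) (relink-fixes x∉S y∉S (fixes tight)) ⟩
        missed L              ∎)
        where
        open ≤-Reasoning
        L = relink x y M
        fewer : ∀ v → 𝟙 (v == x) + (𝟙 (v == y) + 𝟙 (L v == v)) ≤ 𝟙 (M v == v)
        fewer v with view x y M v
        ... | at-x refl e rewrite e | Mx | ==-refl v | ==-≢ x≢y | ==-≢ (x≢y ∘ sym) = ≤-refl
        ... | at-y _ refl e rewrite e | My | ==-refl v | ==-≢ x≢y | ==-≢ (x≢y ∘ sym) = ≤-refl
        ... | at-My _ ne e _ = contradiction (trans e My) ne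
        ... | at-rest p q _ e rewrite e | ==-≢ p | ==-≢ q = ≤-refl

      infix 4 _≈_
      -- No tight matching misses both. This relation stands in for lying in the same component
      -- outside `S`: it is an equivalence there, and its classes are closed under adjacency, which
      -- is all that a barrier asks.
      _≈_ : Fin N → Fin N → Set
      x ≈ y = x ≢ y → ∀ M → Tight M → M x ≡ x → M y ≡ y → ⊥

      ≈-sym : ∀ {x y} → x ≈ y → y ≈ x
      ≈-sym x≈y y≢x M tight My Mx = x≈y (y≢x ∘ sym) M tight Mx My

      adjacent⇒≈ : ∀ {x y} → S x ≡ false → S y ≡ false → H x y ≡ true → x ≈ y
      adjacent⇒≈ x∉S y∉S xy x≢y M tight = no-augmentation tight x∉S y∉S x≢y xy

      agreement : (Fin N → Fin N) → (Fin N → Fin N) → ℕ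
      agreement M M′ = card (λ v → M v == M′ v)

      relink-missed : ∀ {x y M} → Matching M → M x ≡ x → M y ≢ y → x ≢ y → missed (relink x y M) ≡ missed M
      relink-missed {x} {y} {M} match Mx My≢y x≢y = +-cancelʳ-≡ 1 _ _
        (trans (cong (missed L +_) (sym (sum-indicator x))) (trans (sym (sum-+ _ _)) (trans (sum-cong same) (trans (sum-+ _ _) (cong (missed M +_) (sum-indicator (M y)))))))
        where
        L = relink x y M
        My≢x : x ≢ M y
        My≢x e = x≢y (trans (sym Mx) (trans (cong M e) (involutive match y)))
        MMy : M (M y) ≢ M y
        MMy e = My≢y (trans (sym e) (involutive match y))
        same : ∀ v → 𝟙 (L v == v) + 𝟙 (v == x) ≡ 𝟙 (M v == v) + 𝟙 (v == M y)
        same v with view x y M v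
        ... | at-x refl e rewrite e | Mx | ==-refl v | ==-≢ (x≢y ∘ sym) | ==-≢ My≢x = refl
        ... | at-y _ refl e rewrite e | ==-≢ My≢y | ==-≢ (x≢y ∘ sym) | ==-≢ x≢y | ==-≢ (My≢y ∘ sym) = refl
        ... | at-My _ _ refl e rewrite e | ==-refl (M y) | ==-≢ MMy | ==-≢ (My≢x ∘ sym) = refl
        ... | at-rest p _ q e rewrite e | ==-≢ p | ==-≢ q = refl

      relink-agreement : ∀ {x y M M′} → Matching M → Matching M′ → M x ≡ y → M′ x ≡ x → x ≢ y →
        suc (agreement M M′) ≤ agreement M (relink x y M′)
      relink-agreement {x} {y} {M} {M′} match match′ Mx M′x x≢y = begin
        1 + agreement M M′                          ≡⟨ cong (_+ agreement M M′) (sum-indicator x) ⟨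
        card (_== x) + agreement M M′               ≡⟨ sum-+ _ _ ⟨
        sum (λ v → 𝟙 (v == x) + 𝟙 (M v == M′ v))    ≤⟨ sum-mono more ⟩
        agreement M L                               ∎
        where
        open ≤-Reasoning
        L = relink x y M′
        My : M y ≡ x
        My = trans (cong M (sym Mx)) (involutive match x)
        more : ∀ v → 𝟙 (v == x) + 𝟙 (M v == M′ v) ≤ 𝟙 (M v == L v)
        more v with view x y M′ v
        ... | at-x refl e rewrite e | Mx | M′x | ==-refl v | ==-refl y | ==-≢ (x≢y ∘ sym) = ≤-refl
        ... | at-y _ refl e rewrite e | My | ==-refl x | ==-≢ (x≢y ∘ sym) = 𝟙≤1 _
        ... | at-My p q r e rewrite ==-≢ p | ==-≢ (λ s → p (trans (sym (involutive match v)) (trans (cong M (trans s (trans (cong M′ r) (involutive match′ y)))) My))) = z≤n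
        ... | at-rest p _ _ e rewrite e | ==-≢ p = ≤-refl

      -- Gallai's lemma: among the tight matchings missing y, one closest to M would still admit an exchange.
      no-tight-pair : (f : ℕ) → ∀ {x y z} → x ≢ y → y ≢ z → x ≢ z → x ≈ y → y ≈ z →
        ∀ M M′ → Tight M → Tight M′ → M x ≡ x → M z ≡ z → M′ y ≡ y → N < agreement M M′ + f → ⊥
      no-tight-pair zero _ _ _ _ _ M M′ _ _ _ _ _ N< = <-irrefl refl (≤-trans N< (≤-trans (≤-reflexive (+-identityʳ _)) (card≤ (λ v → M v == M′ v))))
      no-tight-pair (suc f) {x} {y} {z} x≢y y≢z x≢z x≈y y≈z M M′ tight tight′ Mx Mz M′y N<
        with any? (λ v → ¬? (v ≟ y) ×-dec (M′ v ≟ v) ×-dec ¬? (M v ≟ v))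
      -- The search cannot fail. `M` misses `x` and `z`, which `M′` covers because `M′` misses `y`.
      -- Both miss equally many vertices, so `M′` misses at least two that `M` covers, and one of
      -- them is not `y`.
      ... | no none = <-irrefl refl (begin-strict
        missed M + 1              <⟨ +-monoʳ-< (missed M) {1} {2} ≤-refl ⟩
        missed M + 2              ≡⟨ cong (_+ 2) (trans (deficit tight) (sym (deficit tight′))) ⟩
        missed M′ + 2             ≡⟨ cong (missed M′ +_) (trans (cong₂ _+_ (sym (sum-indicator x)) (sym (sum-indicator z))) (sym (sum-+ _ _))) ⟩
        missed M′ + sum (λ v → 𝟙 (v == x) + 𝟙 (v == z)) ≡⟨ sum-+ _ _ ⟨
        sum (λ v → 𝟙 (M′ v == v) + (𝟙 (v == x) + 𝟙 (v == z))) ≤⟨ sum-mono bound ⟩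
        sum (λ v → 𝟙 (M v == v) + 𝟙 (v == y)) ≡⟨ sum-+ _ _ ⟩
        missed M + card (_== y)   ≡⟨ cong (missed M +_) (sum-indicator y) ⟩
        missed M + 1              ∎)
        where
        open ≤-Reasoning
        bound : ∀ v → 𝟙 (M′ v == v) + (𝟙 (v == x) + 𝟙 (v == z)) ≤ 𝟙 (M v == v) + 𝟙 (v == y)
        bound v with v ≟ x | v ≟ z | v ≟ y | M′ v ≟ v | M v ≟ v
        ... | yes p | yes q | _ | _ | _ = contradiction (trans (sym p) q) x≢z
        ... | yes refl | no _ | _ | yes e | _ = ⊥-elim (x≈y x≢y M′ tight′ e M′y)
        ... | yes refl | no _ | _ | no _ | no e = contradiction Mx e
        ... | yes refl | no _ | _ | no _ | yes e = s≤s z≤n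
        ... | no _ | yes refl | _ | yes e | _ = ⊥-elim (y≈z y≢z M′ tight′ M′y e)
        ... | no _ | yes refl | _ | no _ | no e = contradiction Mz e
        ... | no _ | yes refl | _ | no _ | yes e = s≤s z≤n
        ... | no _ | no _ | _ | no _ | _ = z≤n
        ... | no _ | no _ | yes _ | yes _ | _ = m≤n+m 1 _
        ... | no _ | no _ | no _ | yes _ | yes _ = ≤-refl
        ... | no _ | no _ | no v≢y | yes e | no e′ = contradiction (v , v≢y , e , e′) none
      ... | yes (v , v≢y , M′v , Mv≢v) with M′ (M v) ≟ M v
      ...   | yes e = no-augmentation tight′ v∉S w∉S (Mv≢v ∘ sym) (edge (matching tight) v Mv≢v) M′v e
        where
        v∉S = ¬-not (λ v∈S → Mv≢v (fixes tight v v∈S))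
        w∉S = ¬-not (λ w∈S → Mv≢v (trans (sym (fixes tight (M v) w∈S)) (involutive (matching tight) v)))
      -- Giving `M′` the edge of `M` at `v` keeps it tight and still missing `y`, and makes it agree
      -- with `M` at `v`. No agreement is lost: the released vertex had another partner in `M` than
      -- in `M′`.
      ...   | no M′w≢w = no-tight-pair f x≢y y≢z x≢z x≈y y≈z M L tight tightL Mx Mz
                (relink-fix (v≢y ∘ sym) (λ { refl → M′w≢w M′y }) M′y)
                (≤-trans N< (≤-trans (≤-reflexive (+-suc _ f)) (+-monoˡ-≤ f (relink-agreement (matching tight) (matching tight′) refl M′v (Mv≢v ∘ sym)))))
        where
        v∉S = ¬-not (λ v∈S → Mv≢v (fixes tight v v∈S))
        w∉S = ¬-not (λ w∈S → Mv≢v (trans (sym (fixes tight (M v) w∈S)) (involutive (matching tight) v)))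
        L = relink v (M v) M′
        tightL : Tight L
        tightL = record
          { matching = relink-matching (matching tight′) M′v (Mv≢v ∘ sym) (edge (matching tight) v Mv≢v)
          ; fixes    = relink-fixes v∉S w∉S (fixes tight′)
          ; deficit  = trans (relink-missed (matching tight′) M′v M′w≢w (Mv≢v ∘ sym)) (deficit tight′) }

      ≈-trans : ∀ {x y z} → S y ≡ false → x ≈ y → y ≈ z → x ≈ z
      ≈-trans {x} {y} {z} y∉S x≈y y≈z x≢z M tight Mx Mz with x ≟ y | y ≟ z
      ... | yes refl | _ = y≈z x≢z M tight Mx Mz
      ... | no _ | yes refl = x≈y x≢z M tight Mx Mz
      ... | no x≢y | no y≢z = tight-missing y y∉S λ (M′ , tight′ , M′y) →
        no-tight-pair (suc N) x≢y y≢z x≢z x≈y y≈z M M′ tight tight′ Mx Mz M′y (m≤n+m _ (agreement M M′))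

      module Components (≈? : ∀ x y → Dec (x ≈ y)) (M : Fin N → Fin N) (tight : Tight M) where

        component : Fin N → Fin N → Bool
        component x y = not (S y) ∧ ⌊ ≈? x y ⌋

        component-intro : ∀ {x y} → S y ≡ false → x ≈ y → component x y ≡ true
        component-intro {x} {y} y∉S x≈y rewrite y∉S with ≈? x y
        ... | yes _ = refl
        ... | no ≉  = contradiction x≈y ≉

        component-elim : ∀ {x y} → component x y ≡ true → S y ≡ false × x ≈ y
        component-elim {x} {y} e with S y | ≈? x y
        ... | false | yes x≈y = refl , x≈y

        ≈-refl : ∀ {x} → x ≈ x
        ≈-refl x≢x = contradiction refl x≢x

        component-invariant : ∀ {M′} → Tight M′ → ∀ x v → component x (M′ v) ≡ component x v
        component-invariant {M′} tight′ x v with M′ v ≟ v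
        ... | yes e = cong (component x) e
        ... | no Mv≢v with component x v in p | component x (M′ v) in q
        ...   | true  | true  = refl
        ...   | false | false = refl
        ...   | true  | false = trans (sym q) (component-intro w∉S (≈-trans (proj₁ (component-elim p)) (proj₂ (component-elim p)) v≈w))
          where
          w∉S = ¬-not (λ w∈S → Mv≢v (trans (sym (fixes tight′ (M′ v) w∈S)) (involutive (matching tight′) v)))
          v≈w = adjacent⇒≈ (proj₁ (component-elim p)) w∉S (edge (matching tight′) v Mv≢v)
        ...   | false | true = sym (trans (sym p) (component-intro v∉S (≈-trans (proj₁ (component-elim q)) (proj₂ (component-elim q)) (≈-sym v≈w))))
          where
          v∉S = ¬-not (λ v∈S → Mv≢v (fixes tight′ v v∈S))
          v≈w = adjacent⇒≈ v∉S (proj₁ (component-elim q)) (edge (matching tight′) v Mv≢v)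

        -- A tight matching missing `x` maps the class of `x` to itself and, by the definition of
        -- `≈`, misses nothing else in it.
        component-odd : ∀ x → S x ≡ false → ¬ ¬ (∃[ j ] card (component x) ≡ 1 + 2 * j)
        component-odd x x∉S k = tight-missing x x∉S λ (M′ , tight′ , M′x) →
          let j , e = involution-parity M′ (involutive (matching tight′)) (component x) (component-invariant tight′ x)
          in k (j , trans e (cong (_+ 2 * j) (trans (sum-cong (only M′ tight′ M′x)) (sum-indicator x))))
          where
          only : ∀ M′ → Tight M′ → M′ x ≡ x → ∀ v → 𝟙 (component x v ∧ M′ v == v) ≡ 𝟙 (v == x)
          only M′ tight′ M′x v with v ≟ x
          ... | yes refl rewrite component-intro x∉S (≈-refl {x}) | M′x | ==-refl x = refl
          ... | no v≢x with component x v in p | M′ v ≟ v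
          ...   | true  | yes e = ⊥-elim (proj₂ (component-elim p) (v≢x ∘ sym) M′ tight′ M′x e)
          ...   | true  | no _  = refl
          ...   | false | _     = refl

        -- An odd class that `M` maps to itself contains a vertex missed by `M`. With `≈` there is
        -- exactly one, and it serves as the representative.
        has-root : ∀ x → S x ≡ false → ¬ ¬ (∃[ u ] M u ≡ u × component x u ≡ true)
        has-root x x∉S k = component-odd x x∉S λ (j , e) →
          let i , e′ = involution-parity M (involutive (matching tight)) (component x) (component-invariant tight x)
          in even≢odd i j (trans (cong (_+ 2 * i) (sym (sum-zero none))) (trans (sym e′) e))
          where
          none : ∀ v → 𝟙 (component x v ∧ M v == v) ≡ 0
          none v with component x v in p | M v ≟ v
          ... | true  | yes e = ⊥-elim (k (v , e , p))
          ... | true  | no _  = refl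
          ... | false | _     = refl

        root? : ∀ x → Dec (∃[ u ] M u ≡ u × component x u ≡ true)
        root? x = any? λ u → (M u ≟ u) ×-dec (component x u Bool.≟ true)

        rep : Fin N → Fin N
        rep x with root? x
        ... | yes (u , _) = u
        -- Never reached outside `S`, since `has-root` refutes a failed search; a barrier constrains
        -- representatives only outside `S`.
        ... | no _        = x

        rep-root : ∀ x → S x ≡ false → M (rep x) ≡ rep x × component x (rep x) ≡ true
        rep-root x x∉S with root? x
        ... | yes (u , p) = p
        ... | no none     = ⊥-elim (has-root x x∉S none)

        rep-unique : ∀ x u → S x ≡ false → M u ≡ u → component x u ≡ true → rep x ≡ u
        rep-unique x u x∉S Mu xu with rep x ≟ u
        ... | yes e = e
        ... | no ne  = let Mr , xr = rep-root x x∉S in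
          ⊥-elim (≈-trans x∉S (≈-sym (proj₂ (component-elim xr))) (proj₂ (component-elim xu)) ne M tight Mr Mu)

        component-class : ∀ u → S u ≡ false → M u ≡ u → ∀ x → component u x ≡ (not (S x) ∧ rep x == u)
        component-class u u∉S Mu x with S x in Sx
        ... | true  = refl
        ... | false with ≈? u x | rep x ≟ u
        ...   | yes _ | yes _ = refl
        ...   | no _  | no _  = refl
        ...   | yes u≈x | no ne = contradiction (rep-unique x u Sx Mu (component-intro u∉S (≈-sym u≈x))) ne
        ...   | no u≉x | yes refl = contradiction (≈-sym (proj₂ (component-elim (proj₂ (rep-root x Sx))))) u≉x

        root⇔missed : ∀ u → (not (S u) ∧ rep u == u) ≡ (not (S u) ∧ M u == u)
        root⇔missed u with S u in Su
        ... | true  = refl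
        ... | false with rep u ≟ u | M u ≟ u
        ...   | yes _ | yes _ = refl
        ...   | no _  | no _  = refl
        ...   | yes e | no ne  = contradiction (subst (λ r → M r ≡ r) e (proj₁ (rep-root u Su))) ne
        ...   | no ne  | yes e = contradiction (rep-unique u u Su e (component-intro Su ≈-refl)) ne

        barrier : ¬ ¬ Barrier
        barrier k = ¬¬-∀ {P = λ u → (not (S u) ∧ M u == u) ≡ true → ∃[ j ] card (component u) ≡ 1 + 2 * j} odds λ odd → k record
          { S      = S
          ; ρ      = rep
          ; ρ∉S    = λ x x∉S → proj₁ (component-elim (proj₂ (rep-root x x∉S)))
          ; ρ-idem = λ x x∉S → let Mr , xr = rep-root x x∉S ; r∉S , _ = component-elim xr in
              rep-unique (rep x) (rep x) r∉S Mr (component-intro r∉S ≈-refl)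
          ; closed = λ x y x∉S y∉S xy → let My , yr = rep-root y y∉S ; r∉S , y≈r = component-elim yr in
              rep-unique x (rep y) x∉S My (component-intro r∉S (≈-trans y∉S (adjacent⇒≈ x∉S y∉S xy) y≈r))
          ; odd    = λ u r → let r′ = trans (sym (root⇔missed u)) r ; j , e = odd u r′ ; u∉S , Mu = missed-elim u r′ in
              j , trans (sum-cong λ x → cong 𝟙 (sym (component-class u u∉S Mu x))) e
          -- The representatives are the vertices outside `S` missed by `M`. All of `S` is missed
          -- too, so `2 + card S` of the `2 + 2 * card S` missed vertices remain.
          ; roots  = trans (sum-cong λ u → cong 𝟙 (root⇔missed u)) count
          }
          where
          missed-elim : ∀ u → (not (S u) ∧ M u == u) ≡ true → S u ≡ false × M u ≡ u
          missed-elim u e with S u | M u ≟ u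
          ... | false | yes Mu = refl , Mu
          odds : ∀ u → ¬ ¬ ((not (S u) ∧ M u == u) ≡ true → ∃[ j ] card (component u) ≡ 1 + 2 * j)
          odds u k with S u in Su
          ... | true  = k λ ()
          ... | false = component-odd u Su λ o → k λ _ → o
          split : ∀ u → 𝟙 (M u == u) ≡ 𝟙 (S u) + 𝟙 (not (S u) ∧ M u == u)
          split u with S u in Su
          ... | false = refl
          ... | true rewrite fixes tight u Su | ==-refl u = refl
          cancel : ∀ s → 2 + 2 * s ≡ s + (2 + s)
          cancel = solve-∀
          count : card (λ u → not (S u) ∧ M u == u) ≡ 2 + card S
          count = +-cancelˡ-≡ (card S) _ _ (trans (sym (sum-+ _ _)) (trans (sum-cong (sym ∘ split)) (trans (deficit tight) (cancel (card S)))))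

    no-perfect⇒barrier : (∀ M → Matching M → (∀ x → M x ≢ x) → ⊥) → ¬ ¬ Barrier
    no-perfect⇒barrier imperfect k = maximal-good N ∅ (m≤n+m N _) good-∅ λ (S , good , maximal) →
      let open Maximal S good maximal in
      -- The goal is now absurdity, so `≈` may be taken as decidable.
      ¬¬-∀ (λ x → ¬¬-∀ {P = λ y → Dec (x ≈ y)} (λ y → ¬¬-dec)) λ ≈? →
      case any? (λ x → S x Bool.≟ false) of λ
        { (yes (x , x∉S)) → tight-missing x x∉S λ (M , tight , _) → Components.barrier ≈? M tight k
        ; (no all) → impossible S good λ x → ¬-not λ p → all (x , p) }
      where
      ∅ : Fin N → Bool
      ∅ _ = false
      id-matching : Matching (λ x → x)
      id-matching = record { involutive = λ _ → refl ; edge = λ _ ne → contradiction refl ne }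
      impossible : ∀ S → Good S → (∀ x → S x ≡ true) → ⊥
      impossible S good all = <-irrefl refl (begin-strict
        card S              <⟨ s≤s (≤-trans (m≤n+m _ 1) (+-monoʳ-≤ 1 (m≤m+n _ (card S + 0)))) ⟩
        2 + 2 * card S      ≤⟨ good (λ x → x) id-matching (λ _ _ → refl) ⟩
        missed (λ x → x)    ≡⟨ sum-cong (λ x → cong 𝟙 (trans (==-refl x) (sym (all x)))) ⟩
        card S              ∎)
        where open ≤-Reasoning
      -- As the order is even, a matching that misses some vertex misses at least two.
      good-∅ : Good ∅
      good-∅ M match _ = ≤-trans (≤-reflexive (cong (λ c → 2 + 2 * c) (sum-zero {f = λ _ → 0} λ _ → refl)))
        (at-least-two (missed M) refl (missed-even M match))
        where
        at-least-two : ∀ c → missed M ≡ c → ∃[ j ] 2 * h ≡ missed M + 2 * j → 2 ≤ c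
        at-least-two (suc (suc _)) _ _       = s≤s (s≤s z≤n)
        at-least-two (suc zero)    e (j , p) = contradiction (trans p (cong (_+ 2 * j) e)) (even≢odd h j)
        at-least-two zero          e _       = ⊥-elim (imperfect M match λ x Mx → <-irrefl refl (≤-trans
          (≤-reflexive (sym (cong 𝟙 (trans (cong (_== x) Mx) (==-refl x))))) (≤-trans (term≤sum (λ x → 𝟙 (M x == x)) x) (≤-reflexive e))))

-- Boundaries and the double count over the odd components.

infixr 6 _⊕_
_⊕_ : ∀ {a b c d} → a ≤ b → c ≤ d → a + c ≤ b + d
_⊕_ = +-mono-≤

third-term : {f : Fin n → ℕ} {i j : Fin n} → i ≢ j → f i + f j < sum f → ∃[ k ] k ≢ i × k ≢ j × 1 ≤ f k
third-term {n} {f} {i} {j} i≢j p with another-term {f = g} j (≤-trans (s≤s (≤-reflexive gj)) rest)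
  where
  g : Fin n → ℕ
  g k = 𝟙 (not (k == i)) * f k
  gj : g j ≡ f j
  gj rewrite ==-≢ (i≢j ∘ sym) = +-identityʳ (f j)
  rest : f j < sum g
  rest = +-cancelˡ-≤ (f i) _ _ (≤-trans (≤-reflexive (+-suc (f i) (f j))) (≤-trans p (≤-reflexive (sum-without f i))))
... | k , k≢j , q with k ≟ i
... | no k≢i = k , k≢i , k≢j , ≤-trans q (≤-reflexive (+-identityʳ (f k)))

sum₂-cong : {f g : Fin m → Fin n → ℕ} → (∀ i j → f i j ≡ g i j) → sum (λ i → sum (f i)) ≡ sum (λ i → sum (g i))
sum₂-cong f≡g = sum-cong λ i → sum-cong (f≡g i)

sum₂-+ : (f g : Fin m → Fin n → ℕ) →
  sum (λ i → sum (λ j → f i j + g i j)) ≡ sum (λ i → sum (f i)) + sum (λ i → sum (g i))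
sum₂-+ f g = trans (sum-cong λ i → sum-+ (f i) (g i)) (sum-+ _ _)

module _ {N : ℕ} (adj : Fin N → Fin N → Bool) where

  nbrSum : (Fin N → ℕ) → Fin N → ℕ
  nbrSum f x = sum (λ y → 𝟙 (adj x y) * f y)

  ∂ : (Fin N → Bool) → ℕ
  ∂ A = sum (λ x → 𝟙 (A x) * nbrSum (𝟙 ∘ not ∘ A) x)

  -- Twice the number of edges inside A.
  inner : (Fin N → Bool) → ℕ
  inner A = sum (λ x → 𝟙 (A x) * nbrSum (𝟙 ∘ A) x)

  weighted : (a : Fin N → ℕ) (f : Fin N → ℕ) →
    sum (λ x → a x * nbrSum f x) ≡ sum (λ x → sum (λ y → a x * (𝟙 (adj x y) * f y)))
  weighted a f = sum-cong λ x → sym (sum-* (a x) _)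

-- What the counting uses of a DCell: `r` is the degree and `b` the number of cliques in the
-- partition. `∂-3` is attained by a triangle. `sparse` and `growth` together keep a set of nearly
-- half the vertices from being nearly independent. Constants stand on the side where they are
-- added, which avoids truncated subtraction.
record Isoperimetric {N : ℕ} (adj : Fin N → Fin N → Bool) (r b : ℕ) : Set where
  field
    adj-sym    : ∀ x y → adj x y ≡ adj y x
    adj-irrefl : ∀ x → adj x x ≡ false
    regular    : ∀ x → card (adj x) ≡ r
    ∂-1        : ∀ A → 1 ≤ card A → card A < N → r ≤ ∂ adj A
    ∂-3        : ∀ A → 3 ≤ card A → card A + 3 ≤ N → 3 * r ≤ ∂ adj A + 6
    sparse     : ∀ A → 2 * card A ≤ inner adj A + 2 * b
    growth     : 2 * b + 2 * r ≤ N
    r≥4        : 4 ≤ r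

module Counting {N r b : ℕ} {adj : Fin N → Fin N → Bool} (iso : Isoperimetric adj r b)
  (deleted : Fin N → Fin N → Bool) (f : ℕ) (size : sum (λ x → card (deleted x)) ≤ 2 * f)
  where
  open Isoperimetric iso

  H : Fin N → Fin N → Bool
  H x y = adj x y ∧ not (deleted x y)

  H⇒adj : ∀ {x y} → H x y ≡ true → adj x y ≡ true
  H⇒adj = proj₁ ∘ ∧-split

  module Solution (no-isolated : ∀ x → ∃[ y ] H x y ≡ true) (barrier : Barrier H) where
    open Barrier barrier

    g d : Fin N → ℕ
    g u = card (class u)
    d u = ∂ adj (class u)

    -- Counted over ordered pairs. An edge leaving a component ends in `S`, and is charged to the
    -- degree of that end, or it is deleted; deleted edges appear in both orientations, hence
    -- `2 * f`. Pairs inside `S` are charged to the degree of their second vertex and do not compete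
    -- with those from outside.
    boundary-count : sum d + inner adj S ≤ r * card S + 2 * f
    boundary-count = begin
      sum d + inner adj S
        ≡⟨ cong₂ _+_ (trans (sum-cong λ u → weighted adj (𝟙 ∘ class u) (𝟙 ∘ not ∘ class u)) (trans (sum-swap _) (sum-cong λ x → sum-swap _))) (weighted adj (𝟙 ∘ S) (𝟙 ∘ S)) ⟩
      sum (λ x → sum (λ y → sum (λ u → across u x y))) + sum (λ x → sum (λ y → inside x y))
        ≡⟨ sum₂-+ _ _ ⟨
      sum (λ x → sum (λ y → sum (λ u → across u x y) + inside x y))
        ≤⟨ sum-mono (λ x → sum-mono (pointwise x)) ⟩
      sum (λ x → sum (λ y → 𝟙 (S y) * 𝟙 (adj x y) + 𝟙 (deleted x y)))
        ≡⟨ sum₂-+ _ _ ⟩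
      sum (λ x → sum (λ y → 𝟙 (S y) * 𝟙 (adj x y))) + sum (λ x → card (deleted x))
        ≤⟨ +-mono-≤ (≤-reflexive degrees) size ⟩
      r * card S + 2 * f ∎
      where
      open ≤-Reasoning
      across : Fin N → Fin N → Fin N → ℕ
      across u x y = 𝟙 (class u x) * (𝟙 (adj x y) * 𝟙 (not (class u y)))
      inside : Fin N → Fin N → ℕ
      inside x y = 𝟙 (S x) * (𝟙 (adj x y) * 𝟙 (S y))
      degrees : sum (λ x → sum (λ y → 𝟙 (S y) * 𝟙 (adj x y))) ≡ r * card S
      degrees = trans (sum-swap _) (trans (sum-cong λ y → trans (sum-* (𝟙 (S y)) _)
        (trans (cong (𝟙 (S y) *_) (trans (sum-cong λ x → cong 𝟙 (adj-sym x y)) (regular y))) (*-comm (𝟙 (S y)) r))) (sum-* r _))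
      pointwise : ∀ x y → sum (λ u → across u x y) + inside x y ≤ 𝟙 (S y) * 𝟙 (adj x y) + 𝟙 (deleted x y)
      pointwise x y with S x in x∉S
      ... | true rewrite sum-zero {f = λ (u : Fin N) → 0} (λ _ → refl) with adj x y | S y
      ...   | true  | true  = s≤s z≤n
      ...   | true  | false = z≤n
      ...   | false | _     = z≤n
      pointwise x y | false = ≤-trans (≤-reflexive (trans (+-identityʳ _) (trans (sum-cong λ u → cong (λ b → 𝟙 b * (𝟙 (adj x y) * 𝟙 (not (class u y)))) (==-sym (ρ x) u)) (sum-single (ρ x) (λ u → 𝟙 (adj x y) * 𝟙 (not (class u y))))))) (main (bool (adj x y)) (bool (deleted x y)))
        where
        main : adj x y ≡ true ⊎ adj x y ≡ false → deleted x y ≡ true ⊎ deleted x y ≡ false →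
          𝟙 (adj x y) * 𝟙 (not (class (ρ x) y)) ≤ 𝟙 (S y) * 𝟙 (adj x y) + 𝟙 (deleted x y)
        main (inj₂ a) _ rewrite a = z≤n
        main (inj₁ a) (inj₁ e) rewrite a | e = ≤-trans (≤-reflexive (+-identityʳ _)) (≤-trans (𝟙≤1 _) (m≤n+m 1 _))
        main (inj₁ a) (inj₂ e) rewrite a | e with S y in y∉S
        ... | true = s≤s z≤n
        ... | false rewrite closed x y x∉S y∉S (cong₂ (λ p q → p ∧ not q) a e) | ==-refl (ρ y) = z≤n

    class⇒ : ∀ {u x} → class u x ≡ true → S x ≡ false × ρ x ≡ u
    class⇒ {u} {x} e with S x | ρ x ≟ u
    ... | false | yes p = refl , p

    class⇐ : ∀ {u x} → S x ≡ false → ρ x ≡ u → class u x ≡ true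
    class⇐ x∉S refl rewrite x∉S = ==-refl _

    root⇒ : ∀ {u} → root u ≡ true → S u ≡ false × ρ u ≡ u
    root⇒ {u} e with S u | ρ u ≟ u
    ... | false | yes p = refl , p

    root-own : ∀ {u} → root u ≡ true → class u u ≡ true
    root-own r = let u∉S , ρu = root⇒ r in class⇐ u∉S ρu

    class⇒root : ∀ {u x} → class u x ≡ true → root u ≡ true
    class⇒root {u} {x} e with class⇒ {u} {x} e
    ... | x∉S , refl rewrite ρ∉S x x∉S | ρ-idem x x∉S = ==-refl (ρ x)

    root≤ : ∀ u → 𝟙 (root u) ≤ g u
    root≤ u with root u in e
    ... | false = z≤n
    ... | true  = ≤-trans (≤-reflexive (sym (cong 𝟙 (root-own e)))) (term≤sum (𝟙 ∘ class u) u)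

    partition : sum g + card S ≡ N
    partition = trans (cong (_+ card S) (trans (sum-swap _) (sum-cong one))) (trans (+-comm _ (card S)) (card-complement S))
      where
      one : ∀ x → sum (λ u → 𝟙 (class u x)) ≡ 𝟙 (not (S x))
      one x with S x
      ... | true  = sum-zero λ _ → refl
      ... | false = trans (sum-cong λ u → cong 𝟙 (==-sym (ρ x) u)) (sum-indicator (ρ x))

    root-another : ∀ {u} → root u ≡ true → ∃[ u′ ] u′ ≢ u × root u′ ≡ true
    root-another {u} e = let u′ , ≢u , p = another-term {f = 𝟙 ∘ root} u (≤-trans (s≤s (𝟙≤1 _)) (≤-trans (m≤m+n 2 _) (≤-reflexive (sym roots))))
      in u′ , ≢u , 1≤𝟙⇒ p

    g-two : ∀ {u u′} → u ≢ u′ → g u + g u′ + card S ≤ N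
    g-two u≢ = ≤-trans (+-monoˡ-≤ (card S) (terms₂≤sum g u≢)) (≤-reflexive partition)

    g-roots : ∀ {u} → root u ≡ true → g u + (1 + card S) + card S ≤ N
    g-roots {u} ru = ≤-trans (+-monoˡ-≤ (card S) others) (≤-reflexive partition)
      where
      open ≤-Reasoning
      others : g u + (1 + card S) ≤ sum g
      others = begin
        g u + (1 + card S) ≡⟨ cong (g u +_) (+-cancelˡ-≡ 1 _ _ (trans (sym roots) (trans (sum-without (𝟙 ∘ root) u) (cong (λ c → 𝟙 c + sum (λ j → 𝟙 (not (j == u)) * 𝟙 (root j))) ru)))) ⟩
        g u + sum (λ j → 𝟙 (not (j == u)) * 𝟙 (root j)) ≤⟨ +-monoʳ-≤ (g u) (sum-mono λ j → *-monoʳ-≤ (𝟙 (not (j == u))) (root≤ j)) ⟩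
        g u + sum (λ j → 𝟙 (not (j == u)) * g j) ≡⟨ sum-without g u ⟨
        sum g ∎

    d≥r : ∀ u → r * 𝟙 (root u) ≤ d u
    d≥r u with root u in e
    ... | false = ≤-trans (≤-reflexive (*-zeroʳ r)) z≤n
    ... | true  = ≤-trans (≤-reflexive (*-identityʳ r)) (∂-1 (class u) (≤-trans (≤-reflexive (cong 𝟙 (sym e))) (root≤ u)) proper)
      where
      proper : g u < N
      proper = let s = card S in ≤-trans (≤-trans (m≤m+n _ (s + s)) (≤-reflexive (shift (g u) s))) (g-roots e)
        where shift : ∀ a s → suc a + (s + s) ≡ a + (1 + s) + s
              shift = solve-∀

    roots-sum : sum (λ u → r * 𝟙 (root u)) ≡ r * (2 + card S)
    roots-sum = trans (sum-* r _) (cong (r *_) roots)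

    sum-d : r * (2 + card S) ≤ sum d
    sum-d = ≤-trans (≤-reflexive (sym roots-sum)) (sum-mono d≥r)

    Large : Fin N → Set
    Large u = root u ≡ true × 2 ≤ g u

    large⇒3 : ∀ {u} → Large u → 3 ≤ g u
    large⇒3 {u} (ru , two) with odd u ru
    ... | zero  , e = contradiction (≤-trans two (≤-reflexive e)) λ { (s≤s ()) }
    ... | suc j , e = ≤-trans (s≤s (s≤s (≤-trans (s≤s z≤n) (m≤n+m _ j)))) (≤-reflexive (sym e))

    -- With S empty, a singleton class would be an isolated vertex.
    S=∅⇒large : card S ≡ 0 → ∀ {u} → root u ≡ true → Large u
    S=∅⇒large s≡0 {u} ru with no-isolated u
    ... | y , uy = ru , ≤-trans (≤-reflexive (cong₂ (λ p q → 𝟙 p + 𝟙 q) (sym (root-own ru)) (sym y∈))) (terms₂≤sum (𝟙 ∘ class u) u≢y)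
      where
      ∉S : ∀ x → S x ≡ false
      ∉S x with S x in e
      ... | false = refl
      ... | true  = contradiction (≤-trans (≤-reflexive (cong 𝟙 (sym e))) (≤-trans (term≤sum (𝟙 ∘ S) x) (≤-reflexive s≡0))) λ ()
      y∈ : class u y ≡ true
      y∈ = class⇐ (∉S y) (trans (sym (closed u y (∉S u) (∉S y) uy)) (proj₂ (root⇒ ru)))
      u≢y : u ≢ y
      u≢y refl = true≢false (trans (sym (H⇒adj uy)) (adj-irrefl u))

    -- If `S` is nonempty, it and the other representatives make up at least three vertices. If `S`
    -- is empty, another component exists and is large as well.
    large⇒co-3 : ∀ {u} → Large u → g u + 3 ≤ N
    large⇒co-3 {u} L with card S in e
    ... | suc s = ≤-trans (≤-trans (m≤m+n _ (s + s)) (≤-reflexive (shift (g u) s))) (subst (λ c → g u + (1 + c) + c ≤ N) e (g-roots (proj₁ L)))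
      where shift : ∀ a s → a + 3 + (s + s) ≡ a + (1 + suc s) + suc s
            shift = solve-∀
    ... | zero = let u′ , ≢u , ru′ = root-another (proj₁ L) in
      ≤-trans (+-monoʳ-≤ (g u) (large⇒3 (S=∅⇒large e ru′))) (≤-trans (m≤m+n _ (card S)) (g-two (≢u ∘ sym)))

    large⇒∂ : ∀ {u} → Large u → 3 * r ≤ d u + 6
    large⇒∂ L = ∂-3 _ (large⇒3 L) (large⇒co-3 L)

    large? : ∀ u → Dec (Large u)
    large? u = (root u Bool.≟ true) ×-dec (2 ≤? g u)

    -- `c` is 6 in general, and 5 when the bound for four vertices applies.
    sum-d-at : ∀ {u} c → root u ≡ true → 3 * r ≤ d u + c → r * (2 + card S) + 2 * r ≤ sum d + c
    sum-d-at {u} c ru p = begin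
      r * (2 + card S) + 2 * r                     ≡⟨ cong₂ _+_ roots-sum (at (2 * r)) ⟨
      sum (λ v → r * 𝟙 (root v)) + sum (λ v → 𝟙 (v == u) * (2 * r)) ≡⟨ sum-+ _ _ ⟨
      sum (λ v → r * 𝟙 (root v) + 𝟙 (v == u) * (2 * r)) ≤⟨ sum-mono bound ⟩
      sum (λ v → d v + 𝟙 (v == u) * c)            ≡⟨ sum-+ _ _ ⟩
      sum d + sum (λ v → 𝟙 (v == u) * c)          ≡⟨ cong (sum d +_) (at c) ⟩
      sum d + c                                    ∎
      where
      open ≤-Reasoning
      at : ∀ c → sum (λ v → 𝟙 (v == u) * c) ≡ c
      at c = sum-single u (λ _ → c)
      bound : ∀ v → r * 𝟙 (root v) + 𝟙 (v == u) * (2 * r) ≤ d v + 𝟙 (v == u) * c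
      bound v with v ≟ u
      ... | no _ = +-monoˡ-≤ 0 (d≥r v)
      ... | yes refl rewrite ru = ≤-trans (≤-reflexive (three r)) (≤-trans p (≤-reflexive (cong (d v +_) (sym (+-identityʳ c)))))
        where three : ∀ r → r * 1 + 1 * (2 * r) ≡ 3 * r
              three = solve-∀

    -- With singletons only, `N ≤ 2 + 2 * card S`, so `sparse` and `growth` give `inner adj S` at
    -- least `2r - 2`. Added to the `2r` by which the boundaries exceed `r * card S`, this yields
    -- `4r - 2 ≤ 2f`.
    no-large : (∀ u → ¬ Large u) → 2 * r ≤ f + 1
    no-large none = *-cancelˡ-≤ 2 (arith sum-d boundary-count (sparse S) growth small)
      where
      small : N ≤ 2 + 2 * card S
      small = ≤-trans (≤-reflexive (sym partition)) (≤-trans (+-monoˡ-≤ (card S) (sum-mono {g = 𝟙 ∘ root} tiny)) (≤-reflexive (trans (cong (_+ card S) roots) (cong (2 +_) (cong (card S +_) (sym (+-identityʳ _)))))))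
        where
        tiny : ∀ u → g u ≤ 𝟙 (root u)
        tiny u with root u in e | g u in e′
        ... | true  | zero  = z≤n
        ... | true  | suc zero = ≤-refl
        ... | true  | suc (suc _) = contradiction (e , ≤-trans (s≤s (s≤s z≤n)) (≤-reflexive (sym e′))) (none u)
        ... | false | zero  = z≤n
        ... | false | suc _ = let x , p = positive-term {f = 𝟙 ∘ class u} (≤-trans (s≤s z≤n) (≤-reflexive (sym e′)))
          in contradiction (trans (sym (class⇒root (1≤𝟙⇒ p))) e) true≢false
      arith : ∀ {s D e} → r * (2 + s) ≤ D → D + e ≤ r * s + 2 * f → 2 * s ≤ e + 2 * b → 2 * b + 2 * r ≤ N → N ≤ 2 + 2 * s → 2 * (2 * r) ≤ 2 * (f + 1)
      arith {s} {D} {e} p q u v w = linear 0 (p ⊕ q ⊕ u ⊕ v ⊕ w) (solve (r ∷ s ∷ D ∷ e ∷ f ∷ b ∷ N ∷ []))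

    one-large : ∀ {u} → Large u → 2 * r ≤ f + 3
    one-large L = *-cancelˡ-≤ 2 (arith (sum-d-at 6 (proj₁ L) (large⇒∂ L)) boundary-count)
      where
      arith : ∀ {s D e} → r * (2 + s) + 2 * r ≤ D + 6 → D + e ≤ r * s + 2 * f → 2 * (2 * r) ≤ 2 * (f + 3)
      arith {s} {D} {e} p q = linear e (p ⊕ q) (solve (r ∷ s ∷ D ∷ e ∷ f ∷ []))

    bound : 2 * r ≤ f + 3
    bound with any? large?
    ... | yes (u , L) = one-large L
    ... | no none     = ≤-trans (no-large λ u L → none (u , L)) (+-monoʳ-≤ f (s≤s z≤n))

-- The extremal case: one large component, one vertex in S, two singletons.

module Equality {N r b : ℕ} {adj : Fin N → Fin N → Bool} (iso : Isoperimetric adj r b)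
  (∂-4 : ∀ A → 4 ≤ card A → card A + 4 ≤ N → 3 * r ≤ ∂ adj A + 5)
  (deleted : Fin N → Fin N → Bool) (f : ℕ) (size : sum (λ x → card (deleted x)) ≤ 2 * f)
  (tight : f + 3 ≤ 2 * r)
  where
  open Isoperimetric iso
  open Counting iso deleted f size

  module _ (no-isolated : ∀ x → ∃[ y ] H x y ≡ true) (barrier : Barrier H) where
    open Barrier barrier
    open Solution no-isolated barrier

    one≰zero : ¬ 1 ≤ 0
    one≰zero ()

    some-large : ∃[ u ] Large u
    some-large with any? large?
    ... | yes L   = L
    ... | no none = contradiction (arith (no-large λ u L → none (u , L))) one≰zero
      where
      arith : 2 * r ≤ f + 1 → 1 ≤ 0
      arith p = linear 1 (p ⊕ tight) (solve (r ∷ f ∷ []))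

    u₀ : Fin N
    u₀ = proj₁ some-large

    large₀ : Large u₀
    large₀ = proj₂ some-large

    -- Two large components would give `6r - 12 ≤ 2f`, against `2f ≤ 4r - 6` and `r ≥ 4`.
    only-large : ∀ {u} → u ≢ u₀ → ¬ Large u
    only-large {u} u≢u₀ L = one≰zero (arith twice boundary-count)
      where
      open ≤-Reasoning
      at : ∀ v c → sum (λ x → 𝟙 (x == v) * c) ≡ c
      at v c = sum-single v (λ _ → c)
      twice : r * (2 + card S) + (2 * r + 2 * r) ≤ sum d + (6 + 6)
      twice = begin
        r * (2 + card S) + (2 * r + 2 * r) ≡⟨ cong₂ _+_ roots-sum (cong₂ _+_ (at u (2 * r)) (at u₀ (2 * r))) ⟨
        sum (λ v → r * 𝟙 (root v)) + (sum (λ v → 𝟙 (v == u) * (2 * r)) + sum (λ v → 𝟙 (v == u₀) * (2 * r))) ≡⟨ cong (sum (λ v → r * 𝟙 (root v)) +_) (sum-+ _ _) ⟨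
        sum (λ v → r * 𝟙 (root v)) + sum (λ v → 𝟙 (v == u) * (2 * r) + 𝟙 (v == u₀) * (2 * r)) ≡⟨ sum-+ _ _ ⟨
        sum (λ v → r * 𝟙 (root v) + (𝟙 (v == u) * (2 * r) + 𝟙 (v == u₀) * (2 * r))) ≤⟨ sum-mono pointwise ⟩
        sum (λ v → d v + (𝟙 (v == u) * 6 + 𝟙 (v == u₀) * 6)) ≡⟨ sum-+ _ _ ⟩
        sum d + sum (λ v → 𝟙 (v == u) * 6 + 𝟙 (v == u₀) * 6) ≡⟨ cong (sum d +_) (trans (sum-+ _ _) (cong₂ _+_ (at u 6) (at u₀ 6))) ⟩
        sum d + (6 + 6) ∎
        where
        three : r * 1 + 2 * r ≡ 3 * r
        three = solve (r ∷ [])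
        pointwise : ∀ v → r * 𝟙 (root v) + (𝟙 (v == u) * (2 * r) + 𝟙 (v == u₀) * (2 * r)) ≤ d v + (𝟙 (v == u) * 6 + 𝟙 (v == u₀) * 6)
        pointwise v with v ≟ u | v ≟ u₀
        ... | yes refl | yes refl = contradiction refl u≢u₀
        ... | yes refl | no _ rewrite proj₁ L | +-identityʳ (2 * r + 0) | +-identityʳ (2 * r) = ≤-trans (≤-reflexive three) (large⇒∂ L)
        ... | no _ | yes refl rewrite proj₁ large₀ | +-identityʳ (2 * r) = ≤-trans (≤-reflexive three) (large⇒∂ large₀)
        ... | no _ | no _ = +-monoˡ-≤ 0 (d≥r v)
      arith : ∀ {s D e} → r * (2 + s) + (2 * r + 2 * r) ≤ D + (6 + 6) → D + e ≤ r * s + 2 * f → 1 ≤ 0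
      arith {s} {D} {e} p q = linear (e + 1) (p ⊕ q ⊕ tight ⊕ tight ⊕ r≥4 ⊕ r≥4) (solve (r ∷ s ∷ D ∷ e ∷ f ∷ []))

    singleton : ∀ {u} → u ≢ u₀ → root u ≡ true → g u ≤ 1
    singleton {u} u≢u₀ ru with 2 ≤? g u
    ... | yes two = contradiction (ru , two) (only-large u≢u₀)
    ... | no p    = ≤-pred (≰⇒> p)

    s≥1 : 1 ≤ card S
    s≥1 with card S in e
    ... | suc _ = s≤s z≤n
    ... | zero  = let u , u≢u₀ , ru = root-another (proj₁ large₀) in contradiction (S=∅⇒large e ru) (only-large u≢u₀)

    -- With only three vertices in this component, `N ≤ 2 * card S + 4`. As in `no-large`, the edges
    -- inside `S`, now at least `2r - 4` when counted twice, then exceed what `2f ≤ 4r - 6` allows.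
    large₀≥4 : 4 ≤ g u₀
    large₀≥4 with 4 ≤? g u₀
    ... | yes p = p
    ... | no p  = contradiction (arith (sum-d-at 6 (proj₁ large₀) (large⇒∂ large₀)) boundary-count (sparse S) growth few) one≰zero
      where
      small : ∀ v → g v ≤ 𝟙 (root v) + 𝟙 (v == u₀) * 2
      small v with root v in e | g v in e′ | v ≟ u₀
      ... | _ | zero | _ = z≤n
      ... | false | suc _ | _ = let x , q = positive-term {f = 𝟙 ∘ class v} (≤-trans (s≤s z≤n) (≤-reflexive (sym e′)))
          in contradiction (trans (sym (class⇒root (1≤𝟙⇒ q))) e) true≢false
      ... | true | suc _ | no v≢u₀ = ≤-trans (≤-reflexive (sym e′)) (singleton v≢u₀ e)
      ... | true | suc _ | yes refl = ≤-trans (≤-reflexive (sym e′)) (≤-pred (≰⇒> p))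
      few : N ≤ (2 + card S + 2) + card S
      few = ≤-trans (≤-reflexive (sym partition)) (+-monoˡ-≤ (card S) (≤-trans (sum-mono small)
        (≤-reflexive (trans (sum-+ _ _) (cong₂ _+_ roots (sum-single u₀ (λ _ → 2)))))))
      arith : ∀ {s D e} → r * (2 + s) + 2 * r ≤ D + 6 → D + e ≤ r * s + 2 * f → 2 * s ≤ e + 2 * b → 2 * b + 2 * r ≤ N → N ≤ (2 + s + 2) + s → 1 ≤ 0
      arith {s} {D} {e} p q u v w = linear 3 (p ⊕ q ⊕ u ⊕ v ⊕ w ⊕ tight ⊕ tight ⊕ r≥4 ⊕ r≥4) (solve (r ∷ s ∷ D ∷ e ∷ f ∷ b ∷ N ∷ []))

    -- Four vertices outside the large component would allow `∂-4`, hence `4r - 5 ≤ 2f`. So at most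
    -- three lie outside, and they include `S` and `1 + card S` further representatives.
    s≤1 : card S ≤ 1
    s≤1 with g u₀ + 4 ≤? N
    ... | yes p = contradiction (arith (sum-d-at 5 (proj₁ large₀) (∂-4 _ large₀≥4 p)) boundary-count) one≰zero
      where
      arith : ∀ {s D e} → r * (2 + s) + 2 * r ≤ D + 5 → D + e ≤ r * s + 2 * f → 1 ≤ 0
      arith {s} {D} {e} p q = linear e (p ⊕ q ⊕ tight ⊕ tight) (solve (r ∷ s ∷ D ∷ e ∷ f ∷ []))
    ... | no p = *-cancelˡ-≤ 2 (arith (g-roots (proj₁ large₀)) (≰⇒> p))
      where
      arith : ∀ {c s} → c + (1 + s) + s ≤ N → N < c + 4 → 2 * s ≤ 2 * 1
      arith {c} {s} p q = linear 0 (p ⊕ q) (solve (c ∷ s ∷ N ∷ []))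

    v₀ : Fin N
    v₀ = proj₁ (positive-term s≥1)

    v₀-unique : ∀ {z} → S z ≡ true → z ≡ v₀
    v₀-unique {z} z∈S with z ≟ v₀
    ... | yes e = e
    ... | no ne = contradiction (≤-trans (≤-reflexive (cong₂ (λ p q → 𝟙 p + 𝟙 q) (sym z∈S) (sym (1≤𝟙⇒ (proj₂ (positive-term s≥1)))))) (≤-trans (terms₂≤sum (𝟙 ∘ S) ne) s≤1)) λ { (s≤s ()) }

    -- A neighbour outside `S` would lie in the component of `x` and make it large.
    leaf : ∀ {x} → x ≢ u₀ → root x ≡ true → ∀ z → H x z ≡ true → z ≡ v₀
    leaf {x} x≢u₀ rx z xz with S z in z∈S
    ... | true  = v₀-unique z∈S
    ... | false with x ≟ z
    ...   | yes refl = contradiction (trans (sym (H⇒adj xz)) (adj-irrefl x)) true≢false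
    ...   | no x≢z  = contradiction (rx , two) (only-large x≢u₀)
      where
      two : 2 ≤ g x
      two = let x∉S , ρx = root⇒ rx in
        ≤-trans (≤-reflexive (cong₂ (λ p q → 𝟙 p + 𝟙 q) (sym (root-own rx)) (sym (class⇐ z∈S (trans (sym (closed x z x∉S z∈S xz)) ρx)))))
          (terms₂≤sum (𝟙 ∘ class x) x≢z)

    two-leaves : ∃[ x ] ∃[ y ] ∃[ v ] x ≢ y × (∀ z → H x z ≡ true → z ≡ v) × (∀ z → H y z ≡ true → z ≡ v)
    two-leaves =
      let x , x≢u₀ , rx = root-another (proj₁ large₀)
          y , y≢u₀ , y≢x , ry = third-term {f = 𝟙 ∘ root} (x≢u₀ ∘ sym)
            (≤-trans (s≤s (+-mono-≤ (𝟙≤1 (root u₀)) (𝟙≤1 (root x)))) (≤-trans (+-monoʳ-≤ 2 s≥1) (≤-reflexive (sym roots))))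
      in x , y , v₀ , y≢x ∘ sym , leaf x≢u₀ rx , leaf y≢u₀ (1≤𝟙⇒ ry)

-- Two leaves at a common neighbour determine the deleted set.

module Leaves {N r b : ℕ} {adj : Fin N → Fin N → Bool} (iso : Isoperimetric adj r b)
  (deleted : Fin N → Fin N → Bool) (deleted-sym : ∀ a b → deleted a b ≡ deleted b a)
  (f : ℕ) (size : sum (λ x → card (deleted x)) ≤ 2 * f) (tight : f + 3 ≡ 2 * r)
  (x y v : Fin N) (x≢y : x ≢ y) (xv : adj x v ≡ true) (yv : adj y v ≡ true)
  (leaf-x : ∀ z → Counting.H iso deleted f size x z ≡ true → z ≡ v) (leaf-y : ∀ z → Counting.H iso deleted f size y z ≡ true → z ≡ v)
  where
  open Isoperimetric iso

  spoke : Fin N → Fin N → Bool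
  spoke a b = (a == x ∨ a == y) ∧ (adj a b ∧ not (b == v))

  spoke⇒ : ∀ a b → spoke a b ≡ true → (a ≡ x ⊎ a ≡ y) × adj a b ≡ true × b ≢ v
  spoke⇒ a b e with a ≟ x | a ≟ y | adj a b in ab | b ≟ v
  ... | yes p | _     | true | no q = inj₁ p , refl , q
  ... | no _  | yes p | true | no q = inj₂ p , refl , q
  ... | yes p | _     | true | yes q = contradiction e λ ()
  ... | no _  | yes p | true | yes q = contradiction e λ ()
  ... | yes p | _     | false | _ = contradiction e λ ()
  ... | no _  | yes p | false | _ = contradiction e λ ()
  ... | no _  | no _  | _ | _ = contradiction e λ ()

  spoke⇒deleted : ∀ a b → spoke a b ≡ true → deleted a b ≡ true
  spoke⇒deleted a b e with spoke⇒ a b e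
  ... | inj₁ refl , ab , b≢v = ¬-not λ kept → b≢v (leaf-x b (cong₂ (λ p q → p ∧ not q) ab kept))
  ... | inj₂ refl , ab , b≢v = ¬-not λ kept → b≢v (leaf-y b (cong₂ (λ p q → p ∧ not q) ab kept))

  -- The correction for the edge between `x` and `y`, which is a spoke in both orientations but a
  -- single deleted edge.
  chord : Fin N → Fin N → ℕ
  chord a b = 𝟙 (a == x) * (𝟙 (b == y) * 𝟙 (adj x y)) + 𝟙 (a == y) * (𝟙 (b == x) * 𝟙 (adj x y))

  spokes≤ : ∀ a b → 𝟙 (spoke a b) + 𝟙 (spoke b a) ≤ 𝟙 (deleted a b) + chord a b
  spokes≤ a b with spoke a b in p | spoke b a in q
  ... | false | false = z≤n
  ... | true  | false rewrite spoke⇒deleted a b p = s≤s z≤n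
  ... | false | true  rewrite deleted-sym a b | spoke⇒deleted b a q = s≤s z≤n
  ... | true  | true with spoke⇒ a b p | spoke⇒ b a q
  ...   | inj₁ refl , xx , _ | inj₁ refl , _ = contradiction (trans (sym xx) (adj-irrefl x)) true≢false
  ...   | inj₂ refl , yy , _ | inj₂ refl , _ = contradiction (trans (sym yy) (adj-irrefl y)) true≢false
  ...   | inj₁ refl , xy , _ | inj₂ refl , _ rewrite spoke⇒deleted x y p | xy | ==-refl x | ==-refl y | ==-≢ x≢y = s≤s (s≤s z≤n)
  ...   | inj₂ refl , yx , _ | inj₁ refl , _ rewrite spoke⇒deleted y x p | adj-sym x y | yx | ==-refl x | ==-refl y | ==-≢ (x≢y ∘ sym) = s≤s (s≤s z≤n)

  row : ∀ a → adj a v ≡ true → suc (card (λ b → adj a b ∧ not (b == v))) ≡ r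
  row a av = trans (card-delete (adj a) av) (regular a)

  spokes : sum (λ a → card (spoke a)) + 2 ≡ 2 * r
  spokes = begin
    sum (λ a → card (spoke a)) + 2 ≡⟨ cong (_+ 2) (trans (sum-cong split) (trans (sum-+ _ _) (cong₂ _+_ (sum-single x rest) (sum-single y rest)))) ⟩
    rest x + rest y + 2            ≡⟨ shift (rest x) (rest y) ⟩
    suc (rest x) + suc (rest y)    ≡⟨ cong₂ _+_ (row x xv) (row y yv) ⟩
    r + r                          ≡⟨ cong (r +_) (+-identityʳ r) ⟨
    2 * r                          ∎
    where
    open ≡.≡-Reasoning
    rest : Fin N → ℕ
    rest a = card (λ b → adj a b ∧ not (b == v))
    shift : ∀ p q → p + q + 2 ≡ suc p + suc q
    shift = solve-∀
    split : ∀ a → card (spoke a) ≡ 𝟙 (a == x) * rest a + 𝟙 (a == y) * rest a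
    split a with a ≟ x | a ≟ y
    ... | yes p | yes q = contradiction (trans (sym p) q) x≢y
    ... | yes _ | no _  = sym (trans (+-identityʳ _) (+-identityʳ _))
    ... | no _  | yes _ = sym (+-identityʳ _)
    ... | no _  | no _  = sum-zero λ _ → refl

  both-spokes : sum (λ a → sum (λ b → 𝟙 (spoke a b) + 𝟙 (spoke b a))) + 4 ≡ 4 * r
  both-spokes = begin
    sum (λ a → sum (λ b → 𝟙 (spoke a b) + 𝟙 (spoke b a))) + 4 ≡⟨ cong (_+ 4) (trans (sum₂-+ _ _) (cong (σ +_) (sum-swap (λ a b → 𝟙 (spoke b a))))) ⟩
    σ + σ + 4         ≡⟨ shift σ ⟩
    2 * (σ + 2)       ≡⟨ cong (2 *_) spokes ⟩
    2 * (2 * r)       ≡⟨ double r ⟩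
    4 * r             ∎
    where
    open ≡.≡-Reasoning
    σ : ℕ
    σ = sum (λ a → card (spoke a))
    shift : ∀ s → s + s + 4 ≡ 2 * (s + 2)
    shift = solve-∀
    double : ∀ r → 2 * (2 * r) ≡ 4 * r
    double = solve-∀

  chords : sum (λ a → sum (chord a)) ≡ 2 * 𝟙 (adj x y)
  chords = trans (sum₂-+ _ _) (trans (cong₂ _+_ (one x y) (one y x)) (cong (𝟙 (adj x y) +_) (sym (+-identityʳ _))))
    where
    one : ∀ s t → sum (λ a → sum (λ b → 𝟙 (a == s) * (𝟙 (b == t) * 𝟙 (adj x y)))) ≡ 𝟙 (adj x y)
    one s t = trans (sum-cong λ a → sum-* (𝟙 (a == s)) _) (trans (sum-single s (λ _ → sum (λ b → 𝟙 (b == t) * 𝟙 (adj x y)))) (sum-single t (λ _ → 𝟙 (adj x y))))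

  total : sum (λ a → sum (λ b → 𝟙 (deleted a b) + chord a b)) ≤ 2 * f + 2 * 𝟙 (adj x y)
  total = ≤-trans (≤-reflexive (sum₂-+ _ _)) (+-mono-≤ size (≤-reflexive chords))

  -- The spokes number `2r - 2` when counted at `x` and at `y`, whereas `f = 2r - 3`; only a spoke
  -- shared by both ends makes room.
  adjacent : adj x y ≡ true
  adjacent = 1≤𝟙⇒ {adj x y} (*-cancelˡ-≤ 2 (arith {c = 𝟙 (adj x y)} (≤-trans (sum-mono λ a → sum-mono (spokes≤ a)) total) (≤-reflexive (sym both-spokes)) (≤-reflexive tight)))
    where
    arith : ∀ {σ c} → σ ≤ 2 * f + 2 * c → 4 * r ≤ σ + 4 → f + 3 ≤ 2 * r → 2 * 1 ≤ 2 * c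
    arith {σ} {c} p q t = linear 0 (p ⊕ q ⊕ t ⊕ t) (solve (r ∷ σ ∷ c ∷ f ∷ []))

  -- With the chord present, the spokes already account for all `f` deleted edges, so the pointwise
  -- inequality `spokes≤` is an equality everywhere.
  deleted⇒spoke : ∀ a b → deleted a b ≡ true → spoke a b ≡ true ⊎ spoke b a ≡ true
  deleted⇒spoke a b e with spoke a b | spoke b a | entry≤
    where
    row≤ : ∀ a → sum (λ b → 𝟙 (deleted a b) + chord a b) ≤ sum (λ b → 𝟙 (spoke a b) + 𝟙 (spoke b a))
    row≤ = sum-mono-tight (λ a → sum-mono (spokes≤ a)) (arith (≤-trans total (+-monoʳ-≤ (2 * f) (*-monoʳ-≤ 2 (𝟙≤1 (adj x y))))) (≤-reflexive (sym both-spokes)) (≤-reflexive tight))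
      where
      arith : ∀ {τ σ} → τ ≤ 2 * f + 2 * 1 → 4 * r ≤ σ + 4 → f + 3 ≤ 2 * r → τ ≤ σ
      arith {τ} {σ} p q t = linear 0 (p ⊕ q ⊕ t ⊕ t) (solve (r ∷ τ ∷ σ ∷ f ∷ []))
    entry≤ : 𝟙 (deleted a b) + chord a b ≤ 𝟙 (spoke a b) + 𝟙 (spoke b a)
    entry≤ = sum-mono-tight (spokes≤ a) (row≤ a) b
  ... | true  | _    | _ = inj₁ refl
  ... | false | true | _ = inj₂ refl
  ... | false | false | p rewrite e = contradiction p λ ()

  exact : adj x y ≡ true × (∀ a b → deleted a b ≡ true →
    ((a ≡ x ⊎ a ≡ y) × adj a b ≡ true × b ≢ v) ⊎ ((b ≡ x ⊎ b ≡ y) × adj b a ≡ true × a ≢ v))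
  exact = adjacent , λ a b e → Sum.map (spoke⇒ a b) (spoke⇒ b a) (deleted⇒spoke a b e)

-- DCell adjacency in terms of copies and level edges.

𝟙-∧ : ∀ a b → 𝟙 (a ∧ b) ≡ 𝟙 a * 𝟙 b
𝟙-∧ true  b = sym (+-identityʳ _)
𝟙-∧ false b = refl

≡ᵇ-refl : ∀ a → (a ≡ᵇ a) ≡ true
≡ᵇ-refl a = T⇒≡ (≡⇒≡ᵇ a a refl)

≡ᵇ-≢ : ∀ {a b} → a ≢ b → (a ≡ᵇ b) ≡ false
≡ᵇ-≢ {a} {b} a≢b with a ≡ᵇ b in e
... | true  = contradiction (≡ᵇ⇒≡ a b (≡⇒T e)) a≢b
... | false = refl

≡ᵇ-== : (x y : Fin n) → (toℕ x ≡ᵇ toℕ y) ≡ (x == y)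
≡ᵇ-== x y with x ≟ y
... | yes refl = ≡ᵇ-refl (toℕ x)
... | no x≢y  = ≡ᵇ-≢ (x≢y ∘ toℕ-injective)

<ᵇ-true : ∀ {a b} → a < b → (a <ᵇ b) ≡ true
<ᵇ-true a<b = T⇒≡ (<⇒<ᵇ a<b)

<ᵇ-false : ∀ {a b} → b ≤ a → (a <ᵇ b) ≡ false
<ᵇ-false {a} {b} b≤a with a <ᵇ b in e
... | true  = contradiction (<ᵇ⇒< a b (≡⇒T e)) (≤⇒≯ b≤a)
... | false = refl

-- The level edge at vertex u of copy i leads to copy punchIn i u, where it ends at vertex cross i u.
cross : Fin (suc m) → Fin m → Fin m
cross zero    zero    = zero
cross zero    (suc u) = zero
cross (suc i) zero    = i
cross (suc i) (suc u) = suc (cross i u)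

cross-toℕ : (i : Fin (suc m)) (u : Fin m) →
  (toℕ u < toℕ i × toℕ (punchIn i u) ≡ toℕ u × suc (toℕ (cross i u)) ≡ toℕ i) ⊎
  (toℕ i ≤ toℕ u × toℕ (punchIn i u) ≡ suc (toℕ u) × toℕ (cross i u) ≡ toℕ i)
cross-toℕ zero    zero    = inj₂ (z≤n , refl , refl)
cross-toℕ zero    (suc u) = inj₂ (z≤n , refl , refl)
cross-toℕ (suc i) zero    = inj₁ (s≤s z≤n , refl , refl)
cross-toℕ (suc i) (suc u) with cross-toℕ i u
... | inj₁ (p , q , r) = inj₁ (s≤s p , cong suc q , cong suc r)
... | inj₂ (p , q , r) = inj₂ (s≤s p , cong suc q , cong suc r)

module DCells (ν : ℕ) where

  private
    n₀ : ℕ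
    n₀ = suc ν

  t⁺ : ℕ → ℕ
  t⁺ k = suc (t k n₀)

  cell : (k : ℕ) → Fin (t k n₀) → Fin (t k n₀) → Bool
  cell k = dcellAdj k n₀

  vertex : ∀ {k} → Fin (t⁺ k) → Fin (t k n₀) → Fin (t (suc k) n₀)
  vertex = combine

  opposite : ∀ {k} → Fin (t⁺ k) → Fin (t k n₀) → Fin (t (suc k) n₀)
  opposite {k} i u = vertex {k} (punchIn i u) (cross i u)

  cellPair : (k : ℕ) → Fin (t⁺ k) → Fin (t k n₀) → Fin (t⁺ k) → Fin (t k n₀) → Bool
  cellPair k i u j w = if toℕ i ≡ᵇ toℕ j then cell k u w
    else if toℕ i <ᵇ toℕ j then (toℕ u ≡ᵇ (toℕ j ∸ 1)) ∧ (toℕ w ≡ᵇ toℕ i)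
    else (toℕ w ≡ᵇ (toℕ i ∸ 1)) ∧ (toℕ u ≡ᵇ toℕ j)

  cell-vertex : ∀ k i u j w → cell (suc k) (vertex {k} i u) (vertex {k} j w) ≡ cellPair k i u j w
  cell-vertex k i u j w = cong₂ (λ p q → cellPair k (proj₁ p) (proj₂ p) (proj₁ q) (proj₂ q))
    (remQuot-combine {t⁺ k} i u) (remQuot-combine {t⁺ k} j w)

  cell-copy : ∀ k i u w → cell (suc k) (vertex {k} i u) (vertex {k} i w) ≡ cell k u w
  cell-copy k i u w rewrite cell-vertex k i u i w | ≡ᵇ-refl (toℕ i) = refl

  -- Writing the target copy as `punchIn i u′` absorbs the off-by-one in the edge rule, so both
  -- branches of the order comparison reduce to the same equation.
  cell-cross : ∀ k i u u′ w →
    cell (suc k) (vertex {k} i u) (vertex {k} (punchIn i u′) w) ≡ (u′ == u ∧ w == cross i u)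
  cell-cross k i u u′ w rewrite cell-vertex k i u (punchIn i u′) w
    | ≡ᵇ-≢ {toℕ i} {toℕ (punchIn i u′)} (λ e → punchInᵢ≢i i u′ (sym (toℕ-injective e))) with cross-toℕ i u′
  ... | inj₁ (u′<i , e , c) rewrite e | <ᵇ-false (<⇒≤ u′<i) | sym c | ≡ᵇ-== w (cross i u′) | ≡ᵇ-== u u′ | ==-sym u u′ with u′ ≟ u
  ...   | yes refl = ∧-comm _ true
  ...   | no _     = ∧-zeroʳ _
  cell-cross k i u u′ w | inj₂ (i≤u′ , e , c) rewrite e | <ᵇ-true (s≤s i≤u′) | sym c | ≡ᵇ-== w (cross i u′) | ≡ᵇ-== u u′ | ==-sym u u′ with u′ ≟ u
  ...   | yes refl = refl
  ...   | no _     = refl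

  as-vertex : ∀ k (P : Fin (t (suc k) n₀) → Set) → (∀ i u → P (vertex {k} i u)) → ∀ x → P x
  as-vertex k P p x = let q = remQuot {t⁺ k} (t k n₀) x in
    subst P (combine-remQuot {t⁺ k} (t k n₀) x) (p (proj₁ q) (proj₂ q))

  cell-irrefl : ∀ k x → cell k x x ≡ false
  cell-irrefl zero    x = cong not (≡ᵇ-refl (toℕ x))
  cell-irrefl (suc k) = as-vertex k (λ x → cell (suc k) x x ≡ false) λ i u → trans (cell-copy k i u u) (cell-irrefl k u)

  cell-sym : ∀ k x y → cell k x y ≡ cell k y x
  cell-sym zero x y = cong not (trans (≡ᵇ-== x y) (trans (==-sym x y) (sym (≡ᵇ-== y x))))
  cell-sym (suc k) x y = as-vertex k (λ x → cell (suc k) x y ≡ cell (suc k) y x) (λ i u →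
    as-vertex k (λ y → cell (suc k) (vertex {k} i u) y ≡ cell (suc k) y (vertex {k} i u)) (λ j w →
      trans (cell-vertex k i u j w) (trans (pair i u j w) (sym (cell-vertex k j w i u)))) y) x
    where
    pair : ∀ i u j w → cellPair k i u j w ≡ cellPair k j w i u
    pair i u j w with <-cmp (toℕ i) (toℕ j)
    ... | tri< i<j i≢j _ rewrite ≡ᵇ-≢ i≢j | ≡ᵇ-≢ (i≢j ∘ sym) | <ᵇ-true i<j | <ᵇ-false (<⇒≤ i<j) = refl
    ... | tri> _ i≢j j<i rewrite ≡ᵇ-≢ i≢j | ≡ᵇ-≢ (i≢j ∘ sym) | <ᵇ-true j<i | <ᵇ-false (<⇒≤ j<i) = refl
    ... | tri≈ _ i≡j _ rewrite i≡j | ≡ᵇ-refl (toℕ j) = cell-sym k u w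

  -- Every vertex has exactly one edge of the top level. Degrees, boundaries and inner edges all
  -- reduce to the copies through this identity.
  nbrSum-step : ∀ k f i u → nbrSum (cell (suc k)) f (vertex {k} i u) ≡
    nbrSum (cell k) (λ w → f (vertex {k} i w)) u + f (opposite {k} i u)
  nbrSum-step k f i u = begin
    nbrSum (cell (suc k)) f (vertex {k} i u)
      ≡⟨ sum-combine {t⁺ k} _ ⟩
    sum (λ j → sum (λ w → term j w))
      ≡⟨ sum-remove i (λ j → sum (λ w → term j w)) ⟩
    sum (λ w → term i w) + sum (λ u′ → sum (λ w → term (punchIn i u′) w))
      ≡⟨ cong₂ _+_ (sum-cong λ w → cong (λ b → 𝟙 b * f (vertex {k} i w)) (cell-copy k i u w)) (trans (sum-cong other) (sum-single u _)) ⟩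
    nbrSum (cell k) (λ w → f (vertex {k} i w)) u + f (opposite {k} i u) ∎
    where
    open ≡.≡-Reasoning
    term : Fin (t⁺ k) → Fin (t k n₀) → ℕ
    term j w = 𝟙 (cell (suc k) (vertex {k} i u) (vertex {k} j w)) * f (vertex {k} j w)
    other : ∀ u′ → sum (term (punchIn i u′)) ≡ 𝟙 (u′ == u) * f (vertex {k} (punchIn i u′) (cross i u))
    other u′ = trans (sum-cong λ w → trans (cong (λ b → 𝟙 b * f (vertex {k} (punchIn i u′) w)) (cell-cross k i u u′ w))
        (trans (cong (_* f (vertex {k} (punchIn i u′) w)) (𝟙-∧ (u′ == u) (w == cross i u))) (*-assoc (𝟙 (u′ == u)) _ _)))
      (trans (sum-* (𝟙 (u′ == u)) _) (cong (𝟙 (u′ == u) *_) (sum-single (cross i u) (λ w → f (vertex {k} (punchIn i u′) w)))))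

  degree : ∀ k x → nbrSum (cell k) (λ _ → 1) x ≡ ν + k
  degree zero x = +-cancelʳ-≡ 1 _ _ (begin
    nbrSum (cell zero) (λ _ → 1) x + 1 ≡⟨ cong (nbrSum (cell zero) (λ _ → 1) x +_) (sum-indicator x) ⟨
    nbrSum (cell zero) (λ _ → 1) x + card (_== x) ≡⟨ sum-+ _ _ ⟨
    sum (λ y → 𝟙 (cell zero x y) * 1 + 𝟙 (y == x)) ≡⟨ sum-cong one ⟩
    sum (λ (_ : Fin n₀) → 1) ≡⟨ sum-const 1 ⟩
    suc ν * 1 ≡⟨ shift ν ⟩
    ν + 0 + 1 ∎)
    where
    open ≡.≡-Reasoning
    shift : ∀ ν → suc ν * 1 ≡ ν + 0 + 1
    shift = solve-∀
    one : ∀ y → 𝟙 (cell zero x y) * 1 + 𝟙 (y == x) ≡ 1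
    one y rewrite ≡ᵇ-== x y | ==-sym x y with y == x
    ... | true  = refl
    ... | false = refl
  degree (suc k) = as-vertex k (λ x → nbrSum (cell (suc k)) (λ _ → 1) x ≡ ν + suc k) λ i u →
    trans (nbrSum-step k (λ _ → 1) i u) (trans (cong (_+ 1) (degree k u)) (trans (+-comm _ 1) (sym (+-suc ν k))))

  regular : ∀ k x → card (cell k x) ≡ ν + k
  regular k x = trans (sum-cong λ y → sym (*-identityʳ _)) (degree k x)

  module _ (k : ℕ) (A : Fin (t (suc k) n₀) → Bool) where

    copy : Fin (t⁺ k) → Fin (t k n₀) → Bool
    copy i u = A (vertex {k} i u)

    out : Fin (t⁺ k) → ℕ
    out i = sum (λ u → 𝟙 (copy i u) * 𝟙 (not (A (opposite {k} i u))))

    card-copies : card A ≡ sum (λ i → card (copy i))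
    card-copies = sum-combine {t⁺ k} _

    weighted-step : ∀ f → sum (λ x → 𝟙 (A x) * nbrSum (cell (suc k)) f x) ≡
      sum (λ i → sum (λ u → 𝟙 (copy i u) * nbrSum (cell k) (λ w → f (vertex {k} i w)) u) + sum (λ u → 𝟙 (copy i u) * f (opposite {k} i u)))
    weighted-step f = trans (sum-combine {t⁺ k} _) (sum-cong λ i → trans (sum-cong λ u →
      trans (cong (𝟙 (copy i u) *_) (nbrSum-step k f i u)) (*-distribˡ-+ (𝟙 (copy i u)) _ _)) (sum-+ _ _))

    ∂-copies : ∂ (cell (suc k)) A ≡ sum (λ i → ∂ (cell k) (copy i) + out i)
    ∂-copies = weighted-step _

    inner-copies : sum (λ i → inner (cell k) (copy i)) ≤ inner (cell (suc k)) A
    inner-copies = ≤-trans (sum-mono λ i → m≤m+n _ _) (≤-reflexive (sym (weighted-step _)))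

    card-copy≡0⇒ : ∀ i → card (copy i) ≡ 0 → ∀ u → copy i u ≡ false
    card-copy≡0⇒ i e u with copy i u in p
    ... | false = refl
    ... | true  = contradiction (≤-trans (≤-reflexive (cong 𝟙 (sym p))) (≤-trans (term≤sum (𝟙 ∘ copy i) u) (≤-reflexive e))) λ ()

    out-alone : ∀ {i} → (∀ j → j ≢ i → card (copy j) ≡ 0) → card (copy i) ≤ out i
    out-alone {i} empty = sum-mono λ u → ≤-reflexive (sym (trans (cong (λ b → 𝟙 (copy i u) * 𝟙 (not b))
      (card-copy≡0⇒ (punchIn i u) (empty (punchIn i u) (punchInᵢ≢i i u)) (cross i u))) (*-identityʳ _)))

    -- Of the level edges at copy `i`, only the single one leading to copy `j` can stay inside `A`.
    out-pair : ∀ {i j} → (∀ l → l ≢ i → l ≢ j → card (copy l) ≡ 0) → card (copy i) ≤ out i + 1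
    out-pair {i} {j} empty = begin
      card (copy i)                                             ≤⟨ sum-mono pointwise ⟩
      sum (λ u → 𝟙 (copy i u) * 𝟙 (not (A (opposite {k} i u))) + 𝟙 (punchIn i u == j)) ≡⟨ sum-+ _ _ ⟩
      out i + sum (λ u → 𝟙 (punchIn i u == j))                  ≤⟨ +-monoʳ-≤ (out i) (m≤n+m _ (𝟙 (i == j))) ⟩
      out i + (𝟙 (i == j) + sum (λ u → 𝟙 (punchIn i u == j)))   ≡⟨ cong (out i +_) (trans (sym (sum-remove i (λ l → 𝟙 (l == j)))) (sum-indicator j)) ⟩
      out i + 1                                                 ∎
      where
      open ≤-Reasoning
      pointwise : ∀ u → 𝟙 (copy i u) ≤ 𝟙 (copy i u) * 𝟙 (not (A (opposite {k} i u))) + 𝟙 (punchIn i u == j)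
      pointwise u with punchIn i u ≟ j
      ... | yes _ = ≤-trans (𝟙≤1 _) (m≤n+m 1 _)
      ... | no ne = ≤-reflexive (sym (trans (+-identityʳ _) (trans (cong (λ b → 𝟙 (copy i u) * 𝟙 (not b))
        (card-copy≡0⇒ (punchIn i u) (empty (punchIn i u) (punchInᵢ≢i i u) ne) (cross i u))) (*-identityʳ _))))

-- Boundaries inside one copy, weighted by the higher levels.

-- Here `a` vertices of K_n, each with `K = 1 + c` further edges, have boundary `a(ā + K)`. Its
-- excess over the same quantity for `j` vertices factors as `(a - j)(ā + K - j)`. The remainder
-- terms here and in the next two lemmas are this product for j = 1, 2, 3.
complete-one : ∀ {ν} a ā c → 1 ≤ a → a + ā ≡ suc ν → ν + 0 + 1 + c ≤ a * ā + (1 + c) * a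
complete-one (suc p) ā c _ refl = ≤-trans (m≤m+n _ (p * ā + c * p)) (≤-reflexive (solve (p ∷ ā ∷ c ∷ [])))

complete-two : ∀ {ν} a ā c → 2 ≤ a → 1 ≤ c → a + ā ≡ suc ν → 2 * (ν + 0 + c) ≤ a * ā + (1 + c) * a
complete-two (suc zero) ā c (s≤s ()) _ _
complete-two (suc (suc p)) ā (suc c) _ _ refl = ≤-trans (m≤m+n _ (p * ā + c * p)) (≤-reflexive (solve (p ∷ ā ∷ c ∷ [])))

complete-many : ∀ {ν} a ā c q → 3 ≤ q → q ≤ 4 → q ≤ a → q ≤ 1 + c → a + ā ≡ suc ν →
  3 * (ν + 0 + 1 + c) + q ≤ a * ā + (1 + c) * a + 9
complete-many _ _ _ 1 (s≤s ()) _ _ _ _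
complete-many _ _ _ 2 (s≤s (s≤s ())) _ _ _ _
complete-many (suc (suc (suc p))) ā (suc (suc c)) 3 _ _ _ _ refl =
  ≤-trans (m≤m+n _ (p * ā + c * p)) (≤-reflexive (solve (p ∷ ā ∷ c ∷ [])))
-- Four vertices and `K ≥ 4` make the product for j = 3 at least 1; that unit pays for raising `q`
-- from 3 to 4.
complete-many (suc (suc (suc (suc p)))) ā (suc (suc (suc c))) 4 _ _ _ _ refl =
  ≤-trans (m≤m+n _ ((1 + p) * ā + c * (1 + p) + p)) (≤-reflexive (solve (p ∷ ā ∷ c ∷ [])))
complete-many (suc (suc (suc _))) _ 1 3 _ _ _ (s≤s (s≤s ())) _
complete-many (suc (suc (suc _))) _ 0 3 _ _ _ (s≤s ()) _
complete-many 2 _ _ 3 _ _ (s≤s (s≤s ())) _ _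
complete-many 1 _ _ 3 _ _ (s≤s ()) _ _
complete-many 3 _ _ 4 _ _ (s≤s (s≤s (s≤s ()))) _ _
complete-many 2 _ _ 4 _ _ (s≤s (s≤s ())) _ _
complete-many 1 _ _ 4 _ _ (s≤s ()) _ _
complete-many (suc (suc (suc (suc _)))) _ 2 4 _ _ _ (s≤s (s≤s (s≤s ()))) _
complete-many (suc (suc (suc (suc _)))) _ 1 4 _ _ _ (s≤s (s≤s ())) _
complete-many (suc (suc (suc (suc _)))) _ 0 4 _ _ _ (s≤s ()) _
complete-many _ _ _ (suc (suc (suc (suc (suc _))))) _ (s≤s (s≤s (s≤s (s≤s ())))) _ _ _

complete-proper : ∀ {ν} a ā → 1 ≤ a → a < suc ν → a + ā ≡ suc ν → ν + 0 ≤ a * ā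
complete-proper (suc p) zero _ p< refl = contradiction (≤-trans p< (≤-reflexive (cong suc (+-identityʳ p)))) (<-irrefl refl)
complete-proper (suc p) (suc q) _ _ refl = ≤-trans (m≤m+n _ (p * q)) (≤-reflexive (solve (p ∷ q ∷ [])))

-- This is `(a - 1)(a - 2) ≥ 0`.
complete-sparse : ∀ a i → i + a ≡ a * a → 2 * a ≤ i + 2 * 1
complete-sparse 0 i _ = z≤n
complete-sparse 1 i _ = m≤n+m 2 i
complete-sparse (suc (suc p)) i e = linear (p + p * p) (≤-reflexive (sym e)) (solve (p ∷ i ∷ []))

module Isoperimetry (ν : ℕ) where
  open DCells ν

  ∂-complement : ∀ k A → ∂ (cell k) (not ∘ A) ≡ ∂ (cell k) A
  ∂-complement k A = trans (weighted (cell k) (𝟙 ∘ not ∘ A) (𝟙 ∘ not ∘ not ∘ A)) (trans (sum-swap _) (trans (sum₂-cong flip) (sym (weighted (cell k) (𝟙 ∘ A) (𝟙 ∘ not ∘ A)))))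
    where
    flip : ∀ y x → 𝟙 (not (A x)) * (𝟙 (cell k x y) * 𝟙 (not (not (A y)))) ≡ 𝟙 (A y) * (𝟙 (cell k y x) * 𝟙 (not (A x)))
    flip y x rewrite cell-sym k x y with A x | A y
    ... | true  | false = refl
    ... | true  | true  = sym (trans (+-identityʳ _) (*-zeroʳ (𝟙 (cell k y x))))
    ... | false | true  = refl
    ... | false | false = trans (+-identityʳ _) (*-zeroʳ (𝟙 (cell k y x)))

  complete-∂ : ∀ A → ∂ (cell 0) A ≡ card A * card (not ∘ A)
  complete-∂ A = trans (sum-cong row) (trans (sum-* (card (not ∘ A)) _) (*-comm (card (not ∘ A)) (card A)))
    where
    row : ∀ x → 𝟙 (A x) * nbrSum (cell 0) (𝟙 ∘ not ∘ A) x ≡ card (not ∘ A) * 𝟙 (A x)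
    row x with A x in Ax
    ... | false = sym (*-zeroʳ (card (not ∘ A)))
    ... | true  = trans (+-identityʳ _) (trans (sum-cong entry) (sym (*-identityʳ _)))
      where
      entry : ∀ y → 𝟙 (cell 0 x y) * 𝟙 (not (A y)) ≡ 𝟙 (not (A y))
      entry y rewrite ≡ᵇ-== x y with x ≟ y
      ... | no _ = +-identityʳ _
      ... | yes refl rewrite Ax = refl

  complete-inner : ∀ A → inner (cell 0) A + card A ≡ card A * card A
  complete-inner A = trans (sym (sum-+ _ _)) (trans (sum-cong row) (sum-* (card A) _))
    where
    row : ∀ x → 𝟙 (A x) * nbrSum (cell 0) (𝟙 ∘ A) x + 𝟙 (A x) ≡ card A * 𝟙 (A x)
    row x with A x in Ax
    ... | false = sym (*-zeroʳ (card A))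
    ... | true  = trans (cong₂ _+_ (+-identityʳ _) (sym (sum-indicator x))) (trans (sym (sum-+ _ _)) (trans (sum-cong entry) (sym (*-identityʳ _))))
      where
      entry : ∀ y → 𝟙 (cell 0 x y) * 𝟙 (A y) + 𝟙 (y == x) ≡ 𝟙 (A y)
      entry y rewrite ≡ᵇ-== x y | ==-sym x y with y ≟ x
      ... | no _ = trans (+-identityʳ _) (+-identityʳ _)
      ... | yes refl rewrite Ax = refl

  data Spread (k : ℕ) (A : Fin (t (suc k) (suc ν)) → Bool) : Set where
    alone : ∀ i → card A ≡ card (copy k A i) →
      ∂ (cell k) (copy k A i) + card (copy k A i) ≤ ∂ (cell (suc k)) A → Spread k A
    many : ∀ i j → i ≢ j → 1 ≤ card (copy k A i) → 1 ≤ card (copy k A j) → Spread k A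

  spread : ∀ k (A : Fin (t (suc k) (suc ν)) → Bool) → 1 ≤ card A → Spread k A
  spread k A p with positive-term (subst (1 ≤_) (card-copies k A) p)
  ... | i , q with any? (λ j → ¬? (j ≟ i) ×-dec (1 ≤? card (copy k A j)))
  ...   | yes (j , j≢i , q′) = many i j (j≢i ∘ sym) q q′
  ...   | no none = alone i
          (trans (card-copies k A) (trans (sum-without _ i) (trans (cong (card (copy k A i) +_) (sum-zero rest)) (+-identityʳ _))))
          (≤-trans (+-monoʳ-≤ (∂ (cell k) (copy k A i)) (out-alone k A empty))
            (≤-trans (term≤sum (λ i → ∂ (cell k) (copy k A i) + out k A i) i) (≤-reflexive (sym (∂-copies k A)))))
          where
          empty : ∀ j → j ≢ i → card (copy k A j) ≡ 0
          empty j j≢i with card (copy k A j) in e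
          ... | zero  = refl
          ... | suc _ = contradiction (j , j≢i , ≤-trans (s≤s z≤n) (≤-reflexive (sym e))) none
          rest : ∀ j → 𝟙 (not (j == i)) * card (copy k A j) ≡ 0
          rest j with j ≟ i
          ... | yes _  = refl
          ... | no j≢i = trans (+-identityʳ _) (empty j j≢i)

  module _ (k : ℕ) (A : Fin (t (suc k) (suc ν)) → Bool) (c : ℕ) where

    -- For a set `B` in one copy of `D_k`, `∂ (cell k) B + (1 + c) * card B` is its boundary in
    -- `D_{k+1+c}`: each vertex has `1 + c` edges of higher levels, and all of them leave. Here the
    -- edges between the copies of `D_k` are omitted, since they may stay inside `A`.
    weight : Fin (t⁺ k) → ℕ
    weight i = ∂ (cell k) (copy k A i) + (1 + c) * card (copy k A i)

    weights : sum weight ≤ ∂ (cell (suc k)) A + (1 + c) * card A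
    weights = ≤-trans (≤-reflexive (sum-+ _ _)) (+-mono-≤
      (≤-trans (sum-mono λ i → m≤m+n _ (out k A i)) (≤-reflexive (sym (∂-copies k A))))
      (≤-reflexive (trans (sum-* (1 + c) _) (cong ((1 + c) *_) (sym (card-copies k A))))))

    weights₂ : ∀ {i j} → i ≢ j → weight i + weight j ≤ ∂ (cell (suc k)) A + (1 + c) * card A
    weights₂ i≢j = ≤-trans (terms₂≤sum weight i≢j) weights

  data Third (k : ℕ) (A : Fin (t (suc k) (suc ν)) → Bool) (i j : Fin (t⁺ k)) : Set where
    third : ∀ l → l ≢ i → l ≢ j → 1 ≤ card (copy k A l) → Third k A i j
    pair : (∀ l → l ≢ i → l ≢ j → card (copy k A l) ≡ 0) → card A ≡ card (copy k A i) + card (copy k A j) → Third k A i j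

  third? : ∀ k (A : Fin (t (suc k) (suc ν)) → Bool) {i j} → i ≢ j → Third k A i j
  third? k A {i} {j} i≢j with any? (λ l → ¬? (l ≟ i) ×-dec ¬? (l ≟ j) ×-dec (1 ≤? card (copy k A l)))
  ... | yes (l , l≢i , l≢j , q) = third l l≢i l≢j q
  ... | no none = pair empty (trans (card-copies k A) (trans (sum-cong split) (trans (sum-+ _ _) (cong₂ _+_ (sum-single i size) (sum-single j size)))))
    where
    size : Fin (t⁺ k) → ℕ
    size l = card (copy k A l)
    empty : ∀ l → l ≢ i → l ≢ j → card (copy k A l) ≡ 0
    empty l l≢i l≢j with card (copy k A l) in e
    ... | zero  = refl
    ... | suc _ = contradiction (l , l≢i , l≢j , ≤-trans (s≤s z≤n) (≤-reflexive (sym e))) none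
    split : ∀ l → size l ≡ 𝟙 (l == i) * size l + 𝟙 (l == j) * size l
    split l with l ≟ i | l ≟ j
    ... | yes p | yes q = contradiction (trans (sym p) q) i≢j
    ... | yes _ | no _  = sym (trans (+-identityʳ _) (+-identityʳ _))
    ... | no _  | yes _ = sym (+-identityʳ _)
    ... | no p  | no q  = empty l p q

  -- The slack c gains one each time the induction descends into a single copy, since every vertex
  -- of that copy then has its level edge in the boundary.
  slack-one : ∀ k c A → 1 ≤ card A → ν + k + 1 + c ≤ ∂ (cell k) A + (1 + c) * card A
  slack-one zero c A p = subst (λ d → ν + 0 + 1 + c ≤ d + (1 + c) * card A) (sym (complete-∂ A))
    (complete-one (card A) (card (not ∘ A)) c p (card-complement A))
  slack-one (suc k) c A p with spread k A p
  ... | alone i e q = subst (λ a → ν + suc k + 1 + c ≤ ∂ (cell (suc k)) A + (1 + c) * a) (sym e)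
          (arith (slack-one k (1 + c) (copy k A i) (subst (1 ≤_) e p)) q)
    where
    arith : ∀ {d a D} → ν + k + 1 + (1 + c) ≤ d + (1 + (1 + c)) * a → d + a ≤ D → ν + suc k + 1 + c ≤ D + (1 + c) * a
    arith {d} {a} {D} p q = linear 0 (p ⊕ q) (solve (ν ∷ k ∷ c ∷ d ∷ a ∷ D ∷ []))
  ... | many i j i≢j pi pj = arith (slack-one k c (copy k A i) pi) (slack-one k c (copy k A j) pj) (weights₂ k A c i≢j)
    where
    arith : ∀ {x y z} → ν + k + 1 + c ≤ x → ν + k + 1 + c ≤ y → x + y ≤ z → ν + suc k + 1 + c ≤ z
    arith {x} {y} {z} p q s = linear (ν + k + c) (p ⊕ q ⊕ s) (solve (ν ∷ k ∷ c ∷ x ∷ y ∷ z ∷ []))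

  -- With `r = ν + k + 1 + c` this is `2r - 2`, attained by two adjacent vertices of a clique. The
  -- condition `1 ≤ k + c` is needed for whole cliques, whose surplus at `k = 0` is
  -- `(n - 2)(c - 1)`.
  slack-two : ∀ k c A → 2 ≤ card A → 1 ≤ k + c → 2 * (ν + k + c) ≤ ∂ (cell k) A + (1 + c) * card A
  slack-two zero c A p r = subst (λ d → 2 * (ν + 0 + c) ≤ d + (1 + c) * card A) (sym (complete-∂ A))
    (complete-two (card A) (card (not ∘ A)) c p r (card-complement A))
  slack-two (suc k) c A p _ with spread k A (≤-trans (s≤s z≤n) p)
  ... | alone i e q = subst (λ a → 2 * (ν + suc k + c) ≤ ∂ (cell (suc k)) A + (1 + c) * a) (sym e)
          (arith (slack-two k (1 + c) (copy k A i) (subst (2 ≤_) e p) (≤-trans (s≤s z≤n) (≤-reflexive (sym (+-suc k c))))) q)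
    where
    arith : ∀ {d a D} → 2 * (ν + k + (1 + c)) ≤ d + (1 + (1 + c)) * a → d + a ≤ D → 2 * (ν + suc k + c) ≤ D + (1 + c) * a
    arith {d} {a} {D} p q = linear 0 (p ⊕ q) (solve (ν ∷ k ∷ c ∷ d ∷ a ∷ D ∷ []))
  ... | many i j i≢j pi pj = arith (slack-one k c (copy k A i) pi) (slack-one k c (copy k A j) pj) (weights₂ k A c i≢j)
    where
    arith : ∀ {x y z} → ν + k + 1 + c ≤ x → ν + k + 1 + c ≤ y → x + y ≤ z → 2 * (ν + suc k + c) ≤ z
    arith {x} {y} {z} p q s = linear 0 (p ⊕ q ⊕ s) (solve (ν ∷ k ∷ c ∷ x ∷ y ∷ z ∷ []))

  one-is-large : ∀ a b → 3 ≤ a + b → 2 ≤ a ⊎ 2 ≤ b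
  one-is-large zero          b p = inj₂ (≤-trans (s≤s (s≤s z≤n)) p)
  one-is-large (suc zero)    b p = inj₂ (≤-pred p)
  one-is-large (suc (suc a)) b p = inj₁ (s≤s (s≤s z≤n))

  -- With `r = ν + k + 1 + c` this is `3r - 6` for `q = 3` and `3r - 5` for `q = 4`; one statement
  -- serves both bounds. The last hypothesis says that the surrounding DCell has level at least `q`.
  slack-many : ∀ k c q A → 3 ≤ q → q ≤ 4 → q ≤ card A → q ≤ k + 1 + c →
    3 * (ν + k + 1 + c) + q ≤ ∂ (cell k) A + (1 + c) * card A + 9
  slack-many zero c q A 3≤q q≤4 p r = subst (λ d → 3 * (ν + 0 + 1 + c) + q ≤ d + (1 + c) * card A + 9) (sym (complete-∂ A))
    (complete-many (card A) (card (not ∘ A)) c q 3≤q q≤4 p r (card-complement A))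
  slack-many (suc k) c q A 3≤q q≤4 p r with spread k A (≤-trans (s≤s z≤n) (≤-trans 3≤q p))
  ... | alone i e s = subst (λ a → 3 * (ν + suc k + 1 + c) + q ≤ ∂ (cell (suc k)) A + (1 + c) * a + 9) (sym e)
          (arith (slack-many k (1 + c) q (copy k A i) 3≤q q≤4 (subst (q ≤_) e p) (≤-trans r (≤-reflexive shift))) s)
    where
    shift : suc k + 1 + c ≡ k + 1 + (1 + c)
    shift = solve (k ∷ c ∷ [])
    arith : ∀ {d a D} → 3 * (ν + k + 1 + (1 + c)) + q ≤ d + (1 + (1 + c)) * a + 9 → d + a ≤ D → 3 * (ν + suc k + 1 + c) + q ≤ D + (1 + c) * a + 9
    arith {d} {a} {D} p s = linear 0 (p ⊕ s) (solve (ν ∷ k ∷ c ∷ d ∷ a ∷ D ∷ q ∷ []))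
  ... | many i j i≢j pi pj with third? k A i≢j
  ...   | third l l≢i l≢j pl = arith (slack-one k c (copy k A i) pi) (slack-one k c (copy k A j) pj) (slack-one k c (copy k A l) pl)
            (≤-trans (terms₃≤sum (weight k A c) i≢j (l≢i ∘ sym) (l≢j ∘ sym)) (weights k A c)) q≤4
    where
    arith : ∀ {x y w z} → ν + k + 1 + c ≤ x → ν + k + 1 + c ≤ y → ν + k + 1 + c ≤ w → x + y + w ≤ z → q ≤ 4 → 3 * (ν + suc k + 1 + c) + q ≤ z + 9
    arith {x} {y} {w} {z} p p′ p″ s q≤ = linear 2 (p ⊕ p′ ⊕ p″ ⊕ s ⊕ q≤) (solve (ν ∷ k ∷ c ∷ x ∷ y ∷ w ∷ z ∷ q ∷ []))
  ...   | pair _ e = split (one-is-large _ _ (≤-trans 3≤q (≤-trans p (≤-reflexive e))))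
    where
    k+c≥1 : 1 ≤ k + c
    k+c≥1 = +-cancelˡ-≤ 2 _ _ (≤-trans 3≤q (≤-trans r (≤-reflexive (solve (k ∷ c ∷ [])))))
    -- For `r = ν + suc k + 1 + c` the two copies give `r - 1` and `2r - 4`, together exactly the
    -- `3r - 5` required for `q = 4`.
    arith : ∀ {x y z} → ν + k + 1 + c ≤ x → 2 * (ν + k + c) ≤ y → x + y ≤ z → q ≤ 4 → 3 * (ν + suc k + 1 + c) + q ≤ z + 9
    arith {x} {y} {z} p p′ s q≤ = linear 0 (p ⊕ p′ ⊕ s ⊕ q≤) (solve (ν ∷ k ∷ c ∷ x ∷ y ∷ z ∷ q ∷ []))
    split : 2 ≤ card (copy k A i) ⊎ 2 ≤ card (copy k A j) → 3 * (ν + suc k + 1 + c) + q ≤ ∂ (cell (suc k)) A + (1 + c) * card A + 9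
    split (inj₁ two) = arith (slack-one k c (copy k A j) pj) (slack-two k c (copy k A i) two k+c≥1) (weights₂ k A c (i≢j ∘ sym)) q≤4
    split (inj₂ two) = arith (slack-one k c (copy k A i) pi) (slack-two k c (copy k A j) two k+c≥1) (weights₂ k A c i≢j) q≤4

-- Boundaries of arbitrary vertex sets.

card-∋ : (P : Fin n → Bool) {x : Fin n} → P x ≡ true → 1 ≤ card P
card-∋ P {x} e = ≤-trans (≤-reflexive (cong 𝟙 (sym e))) (term≤sum (𝟙 ∘ P) x)

card-∌ : (P : Fin n → Bool) {x : Fin n} → P x ≡ false → card P < n
card-∌ P e = ≤-trans (≤-reflexive (+-comm 1 (card P)))
  (≤-trans (+-monoʳ-≤ (card P) (card-∋ (not ∘ P) (cong not e))) (≤-reflexive (card-complement P)))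

card-full : (P : Fin n → Bool) → card P ≡ n → ∀ x → P x ≡ true
card-full P e x = ¬-not λ p → <-irrefl e (card-∌ P p)

pronic-even : ∀ m → ∃[ h ] suc m * m ≡ 2 * h
pronic-even zero    = 0 , refl
pronic-even (suc m) = let h , e = pronic-even m in h + suc m , trans (shift m) (trans (cong (_+ 2 * suc m) e) (sym (*-distribˡ-+ 2 h (suc m))))
  where
  shift : ∀ m → suc (suc m) * suc m ≡ suc m * m + 2 * suc m
  shift = solve-∀

module Boundary (ν : ℕ) (ν≥2 : 2 ≤ ν) where
  open DCells ν
  open Isoperimetry ν

  size : ℕ → ℕ
  size k = t k (suc ν)

  size-linear : ∀ k → ν + k + 1 ≤ size k
  size-linear zero    = ≤-reflexive shift
    where
    shift : ν + 0 + 1 ≡ suc ν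
    shift = solve (ν ∷ [])
  size-linear (suc k) = arith (size-linear k) (m≤m+n _ _)
    where
    arith : ∀ {s} → ν + k + 1 ≤ s → s * 1 ≤ s * 1 + s * s → ν + suc k + 1 ≤ suc s * s
    arith {zero} p _ = contradiction (≤-trans (m≤n+m 1 (ν + k)) p) λ ()
    arith {suc s} p _ = linear (s + s * s + s) p (solve (ν ∷ k ∷ s ∷ []))

  size≥3 : ∀ k → 3 ≤ size k
  size≥3 k = ≤-trans (+-monoˡ-≤ 1 (≤-trans ν≥2 (m≤m+n ν k))) (size-linear k)

  size-triple : ∀ k → 3 * (ν + suc k) ≤ size (suc k)
  size-triple k = arith (size-linear k) (*-monoˡ-≤ (size k) (size≥3 k))
    where
    arith : ∀ {s} → ν + k + 1 ≤ s → 3 * s ≤ s * s → 3 * (ν + suc k) ≤ suc s * s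
    arith {s} p q = linear s (p ⊕ p ⊕ p ⊕ q) (solve (ν ∷ k ∷ s ∷ []))

  -- The number of cliques K_n into which the vertices of `D_k` are partitioned.
  blocks : ℕ → ℕ
  blocks zero    = 1
  blocks (suc k) = suc (size k) * blocks k

  blocks-size : ∀ k → blocks k * suc ν ≡ size k
  blocks-size zero    = +-identityʳ _
  blocks-size (suc k) = trans (*-assoc (suc (size k)) (blocks k) (suc ν)) (cong (suc (size k) *_) (blocks-size k))

  blocks≥1 : ∀ k → 1 ≤ blocks k
  blocks≥1 zero    = ≤-refl
  blocks≥1 (suc k) = *-mono-≤ {1} {suc (size k)} (s≤s z≤n) (blocks≥1 k)

  -- Stated from level two on: at level one there are only `ν + 2` cliques, fewer than
  -- `2 * (ν + 1)`.
  blocks≥ : ∀ k → 2 * (ν + (2 + k)) ≤ blocks (2 + k)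
  blocks≥ k = begin
    2 * (ν + (2 + k))             ≤⟨ *-monoʳ-≤ 2 (≤-trans (≤-reflexive shift) (≤-trans (size-linear (1 + k)) (n≤1+n _))) ⟩
    2 * suc (size (1 + k))        ≡⟨ *-comm 2 _ ⟩
    suc (size (1 + k)) * 2        ≤⟨ *-monoʳ-≤ (suc (size (1 + k))) (*-mono-≤ {2} {suc (size k)} (s≤s (≤-trans (s≤s z≤n) (size≥3 k))) (blocks≥1 k)) ⟩
    suc (size (1 + k)) * blocks (1 + k) ∎
    where
    open ≤-Reasoning
    shift : ν + (2 + k) ≡ ν + (1 + k) + 1
    shift = solve (ν ∷ k ∷ [])

  blocks-growth : ∀ k → 2 ≤ k → 2 * blocks k + 2 * (ν + k) ≤ size k
  blocks-growth (suc zero) (s≤s ())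
  blocks-growth (suc (suc k)) _ = begin
    2 * blocks (2 + k) + 2 * (ν + (2 + k)) ≤⟨ +-monoʳ-≤ (2 * blocks (2 + k)) (blocks≥ k) ⟩
    2 * blocks (2 + k) + blocks (2 + k)    ≡⟨ shift (blocks (2 + k)) ⟩
    blocks (2 + k) * 3                     ≤⟨ *-monoʳ-≤ (blocks (2 + k)) (s≤s ν≥2) ⟩
    blocks (2 + k) * suc ν                 ≡⟨ blocks-size (2 + k) ⟩
    size (2 + k)                           ∎
    where
    open ≤-Reasoning
    shift : ∀ b → 2 * b + b ≡ b * 3
    shift = solve-∀

  cell-sparse : ∀ k A → 2 * card A ≤ inner (cell k) A + 2 * blocks k
  cell-sparse zero A = complete-sparse (card A) (inner (cell 0) A) (complete-inner A)
  cell-sparse (suc k) A = begin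
    2 * card A                                         ≡⟨ trans (cong (2 *_) (card-copies k A)) (sym (sum-* 2 _)) ⟩
    sum (λ i → 2 * card (copy k A i))                  ≤⟨ sum-mono (λ i → cell-sparse k (copy k A i)) ⟩
    sum (λ i → inner (cell k) (copy k A i) + 2 * blocks k) ≡⟨ sum-+ _ _ ⟩
    sum (λ i → inner (cell k) (copy k A i)) + sum (λ (_ : Fin (t⁺ k)) → 2 * blocks k)
      ≤⟨ +-mono-≤ (inner-copies k A) (≤-reflexive (trans (sum-const {t⁺ k} (2 * blocks k)) (shift (suc (size k)) (blocks k)))) ⟩
    inner (cell (suc k)) A + 2 * blocks (suc k)        ∎
    where
    open ≤-Reasoning
    shift : ∀ s b → s * (2 * b) ≡ 2 * (s * b)
    shift = solve-∀

  Connected : ℕ → Set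
  Connected k = ∀ B → 1 ≤ card B → card B < size k → 1 ≤ ∂ (cell k) B

  -- Every copy l other than the full copy i pays one boundary edge on the route from i through l to
  -- the empty copy j.
  full-empty : ∀ k → Connected k → ∀ A {i j} → card (copy k A i) ≡ size k → card (copy k A j) ≡ 0 →
    size k ≤ ∂ (cell (suc k)) A
  full-empty k connected A {i} {j} full empty = begin
    size k                                   ≡⟨ trans (sum-const 1) (*-identityʳ _) ⟨
    sum (λ (_ : Fin (size k)) → 1)           ≤⟨ sum-mono route ⟩
    sum (λ u → 𝟙 (copy k A i u) * 𝟙 (not (A (opposite {k} i u))) + pay (punchIn i u)) ≡⟨ sum-+ _ _ ⟩
    out k A i + sum (λ u → pay (punchIn i u)) ≤⟨ +-monoˡ-≤ _ (m≤n+m (out k A i) _) ⟩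
    pay i + sum (λ u → pay (punchIn i u))    ≡⟨ sum-remove i pay ⟨
    sum pay                                  ≡⟨ ∂-copies k A ⟨
    ∂ (cell (suc k)) A                       ∎
    where
    open ≤-Reasoning
    pay : Fin (t⁺ k) → ℕ
    pay l = ∂ (cell k) (copy k A l) + out k A l
    through : ∀ l w → copy k A l w ≡ true → 1 ≤ pay l
    through l w lw with l ≟ j
    ... | yes refl = contradiction (trans (sym lw) (card-copy≡0⇒ k A j empty w)) true≢false
    ... | no l≢j with copy k A l (punchOut l≢j) in e
    ...   | false = ≤-trans (connected (copy k A l) (card-∋ _ lw) (card-∌ _ e)) (m≤m+n _ _)
    ...   | true  = ≤-trans exit (≤-trans (term≤sum _ u) (m≤n+m (out k A l) _))
      where
      u : Fin (size k)
      u = punchOut l≢j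
      exit : 1 ≤ 𝟙 (copy k A l u) * 𝟙 (not (A (opposite {k} l u)))
      exit rewrite e | punchIn-punchOut l≢j | card-copy≡0⇒ k A j empty (cross l u) = ≤-refl
    route : ∀ u → 1 ≤ 𝟙 (copy k A i u) * 𝟙 (not (A (opposite {k} i u))) + pay (punchIn i u)
    route u with bool (A (opposite {k} i u))
    ... | inj₁ e = ≤-trans (through (punchIn i u) (cross i u) e) (m≤n+m _ (𝟙 (copy k A i u) * 𝟙 (not (A (opposite {k} i u)))))
    ... | inj₂ e = ≤-trans (≤-reflexive (sym (cong₂ (λ a b → 𝟙 a * 𝟙 (not b)) (card-full _ full u) e))) (m≤m+n _ _)

  -- Boundary and size conditions are invariant under complement, which exchanges full and empty
  -- copies. Only sets with both kinds of copy resist, and for them `full-empty` gives `size k`.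
  up-to-complement : ∀ k q X c → Connected k → X ≤ size k + c →
    (∀ A → q ≤ card A → card A + q ≤ size (suc k) → (∀ i → card (copy k A i) < size k) → X ≤ ∂ (cell (suc k)) A + c) →
    ∀ A → q ≤ card A → card A + q ≤ size (suc k) → X ≤ ∂ (cell (suc k)) A + c
  up-to-complement k q X c connected X≤ no-full A p p′
    with any? (λ i → card (copy k A i) ℕ.≟ size k) | any? (λ j → card (copy k A j) ℕ.≟ 0)
  ... | yes (i , full) | yes (j , empty) = ≤-trans X≤ (+-monoˡ-≤ c (full-empty k connected A {i} {j} full empty))
  ... | no none | _ = no-full A p p′ λ i → ≤∧≢⇒< (card≤ (copy k A i)) (λ e → none (i , e))
  ... | yes _ | no none = subst (λ d → X ≤ d + c) (∂-complement (suc k) A) (no-full (not ∘ A)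
        (+-cancelˡ-≤ (card A) _ _ (≤-trans p′ (≤-reflexive (sym (card-complement A)))))
        (≤-trans (+-monoʳ-≤ (card (not ∘ A)) p) (≤-reflexive (trans (+-comm _ (card A)) (card-complement A))))
        λ i → ≤∧≢⇒< (card≤ (copy k (not ∘ A) i)) λ e → none (i , +-cancelʳ-≡ (size k) _ _
          (trans (cong (card (copy k A i) +_) (sym e)) (card-complement (copy k A i)))))

  -- When no copy is full, two nonempty copies already give `2(r - 1) ≥ r`. With a single one, a
  -- level edge supplies the unit by which the degree grows.
  ∂-proper : ∀ k A → 1 ≤ card A → card A < size k → ν + k ≤ ∂ (cell k) A
  ∂-proper zero A p q = subst (ν + 0 ≤_) (sym (complete-∂ A)) (complete-proper (card A) (card (not ∘ A)) p q (card-complement A))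
  ∂-proper (suc k) A p q = ≤-trans (up-to-complement k 1 (ν + suc k) 0 connected
      (≤-trans (≤-reflexive shift) (≤-trans (size-linear k) (m≤m+n _ 0))) no-full A p (≤-trans (≤-reflexive (+-comm _ 1)) q)) (≤-reflexive (+-identityʳ _))
    where
    shift : ν + suc k ≡ ν + k + 1
    shift = solve (ν ∷ k ∷ [])
    connected : Connected k
    connected B p q = ≤-trans (≤-trans (s≤s z≤n) (≤-trans ν≥2 (m≤m+n ν k))) (∂-proper k B p q)
    no-full : ∀ A → 1 ≤ card A → card A + 1 ≤ size (suc k) → (∀ i → card (copy k A i) < size k) → ν + suc k ≤ ∂ (cell (suc k)) A + 0
    no-full A p _ small with spread k A p
    ... | alone i e s = arith (∂-proper k (copy k A i) (subst (1 ≤_) e p) (small i)) (subst (1 ≤_) e p) s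
      where
      arith : ∀ {d a D} → ν + k ≤ d → 1 ≤ a → d + a ≤ D → ν + suc k ≤ D + 0
      arith {d} {a} {D} p q s = linear 0 (p ⊕ q ⊕ s) (solve (ν ∷ k ∷ d ∷ a ∷ D ∷ []))
    ... | many i j i≢j pi pj = arith (∂-proper k (copy k A i) pi (small i)) (∂-proper k (copy k A j) pj (small j)) ν≥2
            (≤-trans (terms₂≤sum (λ i → ∂ (cell k) (copy k A i)) i≢j) (≤-trans (sum-mono λ i → m≤m+n _ _) (≤-reflexive (sym (∂-copies k A)))))
      where
      arith : ∀ {x y D} → ν + k ≤ x → ν + k ≤ y → 2 ≤ ν → x + y ≤ D → ν + suc k ≤ D + 0
      arith {x} {y} {D} p q n s = linear (1 + k) (p ⊕ q ⊕ n ⊕ s) (solve (ν ∷ k ∷ x ∷ y ∷ D ∷ []))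

  -- When no copy is full, three nonempty copies give `3(r - 1)`. A single nonempty copy is the case
  -- of slack 0 of `slack-many`, and two lose at most the one edge between them.
  ∂-many : ∀ k q → 3 ≤ q → q ≤ 4 → q ≤ suc k → ∀ A → q ≤ card A → card A + q ≤ size (suc k) →
    3 * (ν + suc k) + q ≤ ∂ (cell (suc k)) A + 9
  ∂-many zero _ 3≤q _ q≤1 = contradiction (≤-trans 3≤q q≤1) λ { (s≤s ()) }
  ∂-many (suc k) q 3≤q q≤4 q≤ = up-to-complement (suc k) q (3 * (ν + suc (suc k)) + q) 9 connected (arith₀ (size-triple k) q≤4) no-full
    where
    connected : Connected (suc k)
    connected B p q = ≤-trans (≤-trans (s≤s z≤n) (≤-trans ν≥2 (m≤m+n ν (suc k)))) (∂-proper (suc k) B p q)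
    arith₀ : ∀ {s} → 3 * (ν + suc k) ≤ s → q ≤ 4 → 3 * (ν + suc (suc k)) + q ≤ s + 9
    arith₀ {s} p r = linear 2 (p ⊕ r) (solve (ν ∷ k ∷ s ∷ q ∷ []))
    shift : suc (suc k) ≡ suc k + 1 + 0
    shift = solve (k ∷ [])
    no-full : ∀ A → q ≤ card A → card A + q ≤ size (suc (suc k)) → (∀ i → card (copy (suc k) A i) < size (suc k)) →
      3 * (ν + suc (suc k)) + q ≤ ∂ (cell (suc (suc k))) A + 9
    no-full A p _ small with spread (suc k) A (≤-trans (s≤s z≤n) (≤-trans 3≤q p))
    ... | alone i e s = arith {∂ (cell (suc k)) (copy (suc k) A i)} {card (copy (suc k) A i)} (slack-many (suc k) 0 q (copy (suc k) A i) 3≤q q≤4 (subst (q ≤_) e p) (≤-trans q≤ (≤-reflexive shift))) s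
      where
      arith : ∀ {d a D} → 3 * (ν + suc k + 1 + 0) + q ≤ d + (1 + 0) * a + 9 → d + a ≤ D → 3 * (ν + suc (suc k)) + q ≤ D + 9
      arith {d} {a} {D} p s = linear 0 (p ⊕ s) (solve (ν ∷ k ∷ d ∷ a ∷ D ∷ q ∷ []))
    ... | many i j i≢j pi pj with third? (suc k) A i≢j
    ...   | third l l≢i l≢j pl = arith (proper i pi) (proper j pj) (proper l pl) q≤4
            (≤-trans (terms₃≤sum (λ i → ∂ (cell (suc k)) (copy (suc k) A i)) i≢j (l≢i ∘ sym) (l≢j ∘ sym)) (≤-trans (sum-mono λ i → m≤m+n _ _) (≤-reflexive (sym (∂-copies (suc k) A)))))
      where
      proper : ∀ l → 1 ≤ card (copy (suc k) A l) → ν + suc k ≤ ∂ (cell (suc k)) (copy (suc k) A l)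
      proper l pl = ∂-proper (suc k) _ pl (small l)
      arith : ∀ {x y z D} → ν + suc k ≤ x → ν + suc k ≤ y → ν + suc k ≤ z → q ≤ 4 → x + y + z ≤ D → 3 * (ν + suc (suc k)) + q ≤ D + 9
      arith {x} {y} {z} {D} p p′ p″ r s = linear 2 (p ⊕ p′ ⊕ p″ ⊕ r ⊕ s) (solve (ν ∷ k ∷ x ∷ y ∷ z ∷ D ∷ q ∷ []))
    ...   | pair empty e = split (one-is-large _ _ (≤-trans 3≤q (≤-trans p (≤-reflexive e))))
      where
      d o a : Fin (t⁺ (suc k)) → ℕ
      d l = ∂ (cell (suc k)) (copy (suc k) A l)
      o l = out (suc k) A l
      a l = card (copy (suc k) A l)
      two : (d i + o i) + (d j + o j) ≤ ∂ (cell (suc (suc k))) A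
      two = ≤-trans (terms₂≤sum (λ l → d l + o l) i≢j) (≤-reflexive (sym (∂-copies (suc k) A)))
      out-i : a i ≤ o i + 1
      out-i = out-pair (suc k) A {i} {j} empty
      out-j : a j ≤ o j + 1
      out-j = out-pair (suc k) A {j} {i} λ l l≢j l≢i → empty l l≢i l≢j
      -- If all level edges left `A`, the copies would give `r` and `2r - 2` for
      -- `r = ν + suc (suc k)`. The one edge joining them is taken back at both ends, which leaves
      -- `3r - 4`.
      arith : ∀ {di oi ai dj oj aj D} → ν + suc k + 1 + 0 ≤ di + (1 + 0) * ai → 2 * (ν + suc k + 0) ≤ dj + (1 + 0) * aj →
        ai ≤ oi + 1 → aj ≤ oj + 1 → q ≤ 4 → (di + oi) + (dj + oj) ≤ D → 3 * (ν + suc (suc k)) + q ≤ D + 9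
      arith {di} {oi} {ai} {dj} {oj} {aj} {D} p p′ s s′ r w = linear 1 (p ⊕ p′ ⊕ s ⊕ s′ ⊕ r ⊕ w)
        (solve (ν ∷ k ∷ di ∷ oi ∷ ai ∷ dj ∷ oj ∷ aj ∷ D ∷ q ∷ []))
      split : 2 ≤ a i ⊎ 2 ≤ a j → 3 * (ν + suc (suc k)) + q ≤ ∂ (cell (suc (suc k))) A + 9
      split (inj₁ two-i) = arith {d j} {o j} {a j} {d i} {o i} {a i} (slack-one (suc k) 0 (copy (suc k) A j) pj) (slack-two (suc k) 0 (copy (suc k) A i) two-i (s≤s z≤n)) out-j out-i q≤4
        (≤-trans (≤-reflexive (+-comm (d j + o j) (d i + o i))) two)
      split (inj₂ two-j) = arith {d i} {o i} {a i} {d j} {o j} {a j} (slack-one (suc k) 0 (copy (suc k) A i) pi) (slack-two (suc k) 0 (copy (suc k) A j) two-j (s≤s z≤n)) out-i out-j q≤4 two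

  isoperimetric : ∀ k → 2 ≤ k → Isoperimetric (cell (suc k)) (ν + suc k) (blocks (suc k))
  isoperimetric k 2≤k = record
    { adj-sym    = cell-sym (suc k)
    ; adj-irrefl = cell-irrefl (suc k)
    ; regular    = regular (suc k)
    ; ∂-1        = ∂-proper (suc k)
    ; ∂-3        = λ A p q → +-cancelʳ-≤ 3 _ _ (≤-trans (∂-many k 3 ≤-refl (n≤1+n 3) (s≤s 2≤k) A p q) (≤-reflexive (sym (+-assoc _ 6 3))))
    ; sparse     = cell-sparse (suc k)
    ; growth     = blocks-growth (suc k) (≤-trans 2≤k (n≤1+n k))
    ; r≥4        = +-mono-≤ ν≥2 (≤-trans 2≤k (n≤1+n k))
    }

  ∂-four : ∀ k → 3 ≤ k → ∀ A → 4 ≤ card A → card A + 4 ≤ size (suc k) → 3 * (ν + suc k) ≤ ∂ (cell (suc k)) A + 5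
  ∂-four k 3≤k A p q = +-cancelʳ-≤ 4 _ _ (≤-trans (∂-many k 4 (n≤1+n 3) ≤-refl (s≤s 3≤k) A p q) (≤-reflexive (sym (+-assoc _ 5 4))))

-- Edge lists as Boolean relations.

opaque
  unfolding sum

  length-filter-tabulate : {A : Set} (f : Fin n → A) (p : A → Bool) →
    length (filter (T? ∘ p) (tabulate f)) ≡ card (p ∘ f)
  length-filter-tabulate {zero}  f p = refl
  length-filter-tabulate {suc n} f p with p (f zero)
  ... | true  = cong suc (length-filter-tabulate (f ∘ suc) p)
  ... | false = length-filter-tabulate (f ∘ suc) p

  listSum-tabulate : {A : Set} (f : Fin n → A) (g : A → ℕ) → listSum (map g (tabulate f)) ≡ sum (g ∘ f)
  listSum-tabulate {zero}  f g = refl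
  listSum-tabulate {suc n} f g = cong (g (f zero) +_) (listSum-tabulate (f ∘ suc) g)

member : List (Fin n × Fin n) → Fin n → Fin n → Bool
member []            a b = false
member ((c , d) ∷ F) a b = (a == c ∧ b == d) ∨ member F a b

member⇒∈ : ∀ (F : List (Fin n × Fin n)) {a b} → member F a b ≡ true → (a , b) ∈ F
member⇒∈ ((c , d) ∷ F) {a} {b} e with a ≟ c | b ≟ d
... | yes refl | yes refl = here refl
... | yes refl | no _ = there (member⇒∈ F e)
... | no _ | _ = there (member⇒∈ F e)

∈⇒member : ∀ {F : List (Fin n × Fin n)} {a b} → (a , b) ∈ F → member F a b ≡ true
∈⇒member {a = a} {b} (here refl) rewrite ==-refl a | ==-refl b = refl
∈⇒member {F = (c , d) ∷ F} {a} {b} (there p) rewrite ∈⇒member p with a == c ∧ b == d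
... | true  = refl
... | false = refl

member-count : (F : List (Fin n × Fin n)) → sum (λ a → card (member F a)) ≤ length F
member-count []            = ≤-reflexive (sum-zero λ a → sum-zero λ _ → refl)
member-count ((c , d) ∷ F) = ≤-trans (sum-mono λ a → sum-mono (split a)) (≤-trans (≤-reflexive (trans (sum₂-+ _ _)
    (cong (_+ sum (λ a → card (member F a))) one))) (+-monoʳ-≤ 1 (member-count F)))
  where
  split : ∀ a b → 𝟙 (member ((c , d) ∷ F) a b) ≤ 𝟙 (a == c) * 𝟙 (b == d) + 𝟙 (member F a b)
  split a b with a == c | b == d
  ... | true  | true  = s≤s z≤n
  ... | true  | false = ≤-refl
  ... | false | _     = ≤-refl
  one : sum (λ a → sum (λ b → 𝟙 (a == c) * 𝟙 (b == d))) ≡ 1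
  one = trans (sum-cong λ a → sum-* (𝟙 (a == c)) _) (trans (sum-single c (λ _ → card (_== d))) (sum-indicator d))

-- From the counting to conditional matching preclusion.

module Preclusion (G : Graph) {r b : ℕ} (iso : Isoperimetric (adj G) r b) (h : ℕ) (even : N G ≡ 2 * h)
  {m : ℕ} (m+3 : m + 3 ≡ 2 * r)
  {u v w : Fin (N G)} (uv : adj G u v ≡ true) (vw : adj G v w ≡ true) (uw : adj G u w ≡ true)
  where
  open Isoperimetric iso

  V : Set
  V = Fin (N G)

  adj⇒≢ : ∀ {x y} → adj G x y ≡ true → x ≢ y
  adj⇒≢ {x} e refl = true≢false (trans (sym e) (adj-irrefl x))

  b2n≡𝟙 : ∀ c → b2n G c ≡ 𝟙 c
  b2n≡𝟙 true  = refl
  b2n≡𝟙 false = refl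

  deg≡r : ∀ x → deg G x ≡ r
  deg≡r x = trans (listSum-tabulate (λ y → y) (λ y → b2n G (adj G x y))) (trans (sum-cong λ y → b2n≡𝟙 (adj G x y)) (regular x))

  veVal≡ : ∀ x y → veVal G x y ≡ r + r ∸ 2 ∸ 𝟙 (adj G x y)
  veVal≡ x y = cong₂ _∸_ (cong (_∸ 2) (cong₂ _+_ (deg≡r x) (deg≡r y))) (b2n≡𝟙 (adj G x y))

  m≡ : m ≡ r + r ∸ 2 ∸ 1
  m≡ = trans (sym (m+n∸n≡m m 3)) (trans (cong (_∸ 3) (trans m+3 (cong (r +_) (+-identityʳ r)))) (sym (∸-+-assoc (r + r) 2 1)))

  veVal-adjacent : ∀ {x y} → adj G x y ≡ true → veVal G x y ≡ m
  veVal-adjacent {x} {y} e = trans (veVal≡ x y) (trans (cong (λ c → r + r ∸ 2 ∸ 𝟙 c) e) (sym m≡))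

  -- By regularity `veVal` depends only on whether the ends of the path are adjacent, so the paths
  -- inside triangles attain the minimum.
  isVe : IsVe G m
  isVe = (u , v , w , (≡⇒T uv , ≡⇒T vw , adj⇒≢ uw) , veVal-adjacent uw) ,
    λ x _ y _ → ≤-trans (≤-reflexive m≡) (≤-trans (∸-monoʳ-≤ (r + r ∸ 2) (𝟙≤1 (adj G x y))) (≤-reflexive (sym (veVal≡ x y))))

  module _ (F : EdgeList G) (solution : CondSolution G F) where

    deleted : V → V → Bool
    deleted a b = member F a b ∨ member F b a

    deleted-sym : ∀ a b → deleted a b ≡ deleted b a
    deleted-sym a b = ∨-comm (member F a b) (member F b a)

    deleted⇒InF : ∀ {a b} → deleted a b ≡ true → InF G F a b
    deleted⇒InF {a} {b} e with member F a b in p | member F b a in q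
    ... | true  | _    = inj₁ (member⇒∈ F p)
    ... | false | true = inj₂ (member⇒∈ F q)

    InF⇒deleted : ∀ {a b} → InF G F a b → deleted a b ≡ true
    InF⇒deleted {a} {b} (inj₁ p) rewrite ∈⇒member p = refl
    InF⇒deleted {a} {b} (inj₂ p) rewrite ∈⇒member p = ∨-zeroʳ (member F a b)

    deleted-count : sum (λ a → card (deleted a)) ≤ 2 * length F
    deleted-count = ≤-trans (sum-mono λ a → sum-mono λ b → 𝟙-∨ (member F a b) (member F b a)) (≤-trans (≤-reflexive (trans (sum₂-+ _ _)
        (cong (sum (λ a → card (member F a)) +_) (sum-swap _))))
      (≤-trans (+-mono-≤ (member-count F) (member-count F)) (≤-reflexive (cong (length F +_) (sym (+-identityʳ _))))))
      where
      𝟙-∨ : ∀ a b → 𝟙 (a ∨ b) ≤ 𝟙 a + 𝟙 b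
      𝟙-∨ true  b = s≤s z≤n
      𝟙-∨ false b = ≤-refl

    H : V → V → Bool
    H a b = adj G a b ∧ not (deleted a b)

    H⇒EdgeDel : ∀ {a b} → H a b ≡ true → EdgeDel G F a b
    H⇒EdgeDel {a} {b} e with ∧-split {adj G a b} e
    ... | ab , kept = ≡⇒T ab , λ p → true≢false (trans (sym kept) (cong not (InF⇒deleted p)))

    EdgeDel⇒H : ∀ {a b} → EdgeDel G F a b → H a b ≡ true
    EdgeDel⇒H (ab , kept) = cong₂ (λ p q → p ∧ not q) (T⇒≡ ab) (¬-not λ p → kept (deleted⇒InF p))

    H-sym : ∀ a b → H a b ≡ true → H b a ≡ true
    H-sym a b e = trans (cong₂ (λ p q → p ∧ not q) (adj-sym b a) (deleted-sym b a)) e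

    no-isolated : ∀ x → ∃[ y ] H x y ≡ true
    no-isolated x with any? (λ y → H x y Bool.≟ true)
    ... | yes p   = p
    ... | no none = ⊥-elim (proj₂ solution (x , λ y e → none (y , EdgeDel⇒H e)))

    barrier : ¬ ¬ Barrier H
    barrier = Tutte.no-perfect⇒barrier H H-sym h even λ M match fixed-free → proj₁ solution
      (M , Matching.involutive match , fixed-free , λ x → H⇒EdgeDel (Matching.edge match x (fixed-free x)))

    m≤length : m ≤ length F
    -- The inequality is decidable, which removes the double negation from the barrier; `two-leaves`
    -- proceeds likewise by a finite search.
    m≤length = +-cancelʳ-≤ 3 _ _ (≤-trans (≤-reflexive m+3) (decidable-stable (2 * r ≤? length F + 3) λ k →
      barrier λ B → k (Counting.Solution.bound iso deleted (length F) deleted-count no-isolated B)))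

    Leaf : V → V → Set
    Leaf x v = ∀ z → H x z ≡ true → z ≡ v

    leaf? : ∀ x v → Dec (Leaf x v)
    leaf? x v = all? λ z → (H x z Bool.≟ true) →-dec (z ≟ v)

    leaves? : Dec (∃[ x ] ∃[ y ] ∃[ v ] x ≢ y × Leaf x v × Leaf y v)
    leaves? = any? λ x → any? λ y → any? λ v → ¬? (x ≟ y) ×-dec leaf? x v ×-dec leaf? y v

    two-leaves : (∀ A → 4 ≤ card A → card A + 4 ≤ N G → 3 * r ≤ ∂ (adj G) A + 5) → length F + 3 ≤ 2 * r →
      ∃[ x ] ∃[ y ] ∃[ v ] x ≢ y × Leaf x v × Leaf y v
    two-leaves ∂-4 tight = decidable-stable leaves? λ k → barrier λ B →
      k (Equality.two-leaves iso ∂-4 deleted (length F) deleted-count tight no-isolated B)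

    trivial : length F ≡ m → ∀ x y v → x ≢ y → Leaf x v → Leaf y v → TrivialSolution G m F
    trivial size x y v x≢y leaf-x leaf-y =
      x , v , y , (≡⇒T xv , ≡⇒T (trans (adj-sym v y) yv) , x≢y) , veVal-adjacent (proj₁ exact) , λ a b → only-star a b , all-star a b
      where
      edge-to-v : ∀ {x} → Leaf x v → adj G x v ≡ true
      edge-to-v {x} leaf = let z , xz = no-isolated x in subst (λ z → adj G x z ≡ true) (leaf z xz) (proj₁ (∧-split {adj G x z} xz))
      xv : adj G x v ≡ true
      xv = edge-to-v leaf-x
      yv : adj G y v ≡ true
      yv = edge-to-v leaf-y
      exact : adj G x y ≡ true × (∀ a b → deleted a b ≡ true →
        ((a ≡ x ⊎ a ≡ y) × adj G a b ≡ true × b ≢ v) ⊎ ((b ≡ x ⊎ b ≡ y) × adj G b a ≡ true × a ≢ v))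
      exact = Leaves.exact iso deleted deleted-sym (length F) deleted-count (trans (cong (_+ 3) size) m+3) x y v x≢y xv yv leaf-x leaf-y
      Star : V → V → Set
      Star a b = Edge G a b × (a ≡ x ⊎ a ≡ y ⊎ b ≡ x ⊎ b ≡ y) × ¬ SameEdge G (a , b) (x , v) × ¬ SameEdge G (a , b) (v , y)
      off-v : ∀ {a} → a ≡ x ⊎ a ≡ y → a ≢ v
      off-v (inj₁ refl) = adj⇒≢ xv
      off-v (inj₂ refl) = adj⇒≢ yv
      only-star : ∀ a b → InF G F a b → Star a b
      only-star a b p with proj₂ exact a b (InF⇒deleted p)
      ... | inj₁ (e , ab , b≢v) = ≡⇒T ab , [ inj₁ , inj₂ ∘ inj₁ ]′ e ,
        (λ { (inj₁ (_ , q)) → b≢v q ; (inj₂ (q , _)) → off-v e q }) , (λ { (inj₁ (q , _)) → off-v e q ; (inj₂ (_ , q)) → b≢v q })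
      ... | inj₂ (e , ba , a≢v) = ≡⇒T (trans (adj-sym a b) ba) , [ inj₂ ∘ inj₂ ∘ inj₁ , inj₂ ∘ inj₂ ∘ inj₂ ]′ e ,
        (λ { (inj₁ (_ , q)) → off-v e q ; (inj₂ (q , _)) → a≢v q }) , (λ { (inj₁ (q , _)) → a≢v q ; (inj₂ (_ , q)) → off-v e q })
      spoke-from : ∀ {a b} → Leaf a v → adj G a b ≡ true → b ≢ v → InF G F a b
      spoke-from {a} {b} leaf ab b≢v = deleted⇒InF (¬-not λ kept → b≢v (leaf b (cong₂ (λ p q → p ∧ not q) ab kept)))
      flip : ∀ {a b} → InF G F a b → InF G F b a
      flip (inj₁ p) = inj₂ p
      flip (inj₂ p) = inj₁ p
      all-star : ∀ a b → Star a b → InF G F a b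
      all-star a b (ab , inj₁ refl , not-xv , _) = spoke-from leaf-x (T⇒≡ ab) λ e → not-xv (inj₁ (refl , e))
      all-star a b (ab , inj₂ (inj₁ refl) , _ , not-vy) = spoke-from leaf-y (T⇒≡ ab) λ e → not-vy (inj₂ (refl , e))
      all-star a b (ab , inj₂ (inj₂ (inj₁ refl)) , not-xv , _) = flip (spoke-from leaf-x (trans (adj-sym b a) (T⇒≡ ab)) λ e → not-xv (inj₂ (e , refl)))
      all-star a b (ab , inj₂ (inj₂ (inj₂ refl)) , _ , not-vy) = flip (spoke-from leaf-y (trans (adj-sym b a) (T⇒≡ ab)) λ e → not-vy (inj₁ (e , refl)))

  select : (V → Bool) → List V
  select p = filter (T? ∘ p) (allFin (N G))

  -- The edge between `u` and `w` is listed from `u` only, so that no edge of the star occurs twice.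
  atU atW : V → Bool
  atU a = adj G u a ∧ not (a == v)
  atW a = (adj G w a ∧ not (a == v)) ∧ not (a == u)

  star : EdgeList G
  star = map (u ,_) (select atU) ++ map (w ,_) (select atW)

  wv : adj G w v ≡ true
  wv = trans (adj-sym w v) vw

  wu : adj G w u ≡ true
  wu = trans (adj-sym w u) uw

  star-length : length star ≡ m
  star-length = +-cancelʳ-≡ 3 _ _ (begin
    length star + 3             ≡⟨ cong (_+ 3) (length-++ (map (u ,_) (select atU))) ⟩
    length (map (u ,_) (select atU)) + length (map (w ,_) (select atW)) + 3
      ≡⟨ cong (_+ 3) (cong₂ _+_ (trans (length-map (u ,_) (select atU)) (length-filter-tabulate (λ x → x) atU)) (trans (length-map (w ,_) (select atW)) (length-filter-tabulate (λ x → x) atW))) ⟩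
    card atU + card atW + 3     ≡⟨ shift (card atU) (card atW) ⟩
    suc (card atU) + suc (suc (card atW)) ≡⟨ cong₂ _+_ (trans (card-delete (adj G u) uv) (regular u)) (trans (cong suc (card-delete _ wu-kept)) (trans (card-delete (adj G w) wv) (regular w))) ⟩
    r + r                       ≡⟨ cong (r +_) (+-identityʳ r) ⟨
    2 * r                       ≡⟨ m+3 ⟨
    m + 3                       ∎)
    where
    open ≡.≡-Reasoning
    shift : ∀ a b → a + b + 3 ≡ suc a + suc (suc b)
    shift = solve-∀
    wu-kept : (adj G w u ∧ not (u == v)) ≡ true
    wu-kept = cong₂ (λ p q → p ∧ not q) wu (==-≢ (adj⇒≢ uv))

  Spoke : V → V → Set
  Spoke a b = adj G a b ≡ true × b ≢ v × (a ≡ u ⊎ (a ≡ w × b ≢ u))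

  not-==⇒≢ : ∀ {a c : V} → not (a == c) ≡ true → a ≢ c
  not-==⇒≢ {a} e refl = true≢false (trans (sym e) (cong not (==-refl a)))

  star⇒ : ∀ {a b} → (a , b) ∈ star → Spoke a b
  star⇒ {a} {b} p with ∈-++⁻ (map (u ,_) (select atU)) p
  ... | inj₁ q with ∈-map⁻ (u ,_) q
  ...   | c , c∈ , refl = let uc , c≢v = ∧-split {adj G u c} (T⇒≡ (proj₂ (∈-filter⁻ (T? ∘ atU) {xs = allFin (N G)} c∈))) in
    uc , not-==⇒≢ c≢v , inj₁ refl
  star⇒ {a} {b} p | inj₂ q with ∈-map⁻ (w ,_) q
  ...   | c , c∈ , refl = let e , c≢u = ∧-split {adj G w c ∧ not (c == v)} (T⇒≡ (proj₂ (∈-filter⁻ (T? ∘ atW) {xs = allFin (N G)} c∈)))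
                              wc , c≢v = ∧-split {adj G w c} e in
    wc , not-==⇒≢ c≢v , inj₂ (refl , not-==⇒≢ c≢u)

  star-u : ∀ {b} → adj G u b ≡ true → b ≢ v → (u , b) ∈ star
  star-u {b} ub b≢v = ∈-++⁺ˡ (∈-map⁺ (u ,_) (∈-filter⁺ (T? ∘ atU) (∈-allFin b) (≡⇒T (cong₂ (λ p q → p ∧ not q) ub (==-≢ b≢v)))))

  star-w : ∀ {b} → adj G w b ≡ true → b ≢ v → b ≢ u → (w , b) ∈ star
  star-w {b} wb b≢v b≢u = ∈-++⁺ʳ _ (∈-map⁺ (w ,_) (∈-filter⁺ (T? ∘ atW) (∈-allFin b)
    (≡⇒T (cong₂ (λ p q → p ∧ not q) (cong₂ (λ p q → p ∧ not q) wb (==-≢ b≢v)) (==-≢ b≢u)))))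

  star-valid : ValidEdgeSet G star
  star-valid = All.tabulate (λ { {a , b} p → ≡⇒T (proj₁ (star⇒ p)) }) ,
    AllPairs.++⁺ (from u atU) (from w atW) (All.tabulate λ p → All.tabulate λ q → apart (∈-map⁻ (u ,_) p) (∈-map⁻ (w ,_) q))
    where
    from : ∀ x p → AllPairs (λ e e′ → ¬ SameEdge G e e′) (map (x ,_) (select p))
    from x p = AllPairs.map⁺ (Pairs.map
      (λ b≢c → λ { (inj₁ (_ , b≡c)) → b≢c b≡c ; (inj₂ (x≡c , b≡x)) → b≢c (trans b≡x x≡c) }) (Unique.filter⁺ (T? ∘ p) (Unique.allFin⁺ (N G))))
    apart : ∀ {e e′} → ∃[ a ] a ∈ select atU × e ≡ (u , a) →
      ∃[ b ] b ∈ select atW × e′ ≡ (w , b) → ¬ SameEdge G e e′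
    apart (a , _ , refl) (b , _ , refl) (inj₁ (u≡w , _)) = adj⇒≢ uw u≡w
    apart (a , _ , refl) (b , b∈ , refl) (inj₂ (u≡b , _)) =
      not-==⇒≢ (proj₂ (∧-split {adj G w b ∧ not (b == v)} (T⇒≡ (proj₂ (∈-filter⁻ (T? ∘ atW) {xs = allFin (N G)} b∈))))) (sym u≡b)

  star-imperfect : ¬ HasPerfectMatching G star
  star-imperfect (M , MM , _ , edge) = adj⇒≢ uw (trans (sym (MM u)) (trans (cong M (trans Mu (sym Mw))) (MM w)))
    where
    Mu : M u ≡ v
    Mu with M u ≟ v
    ... | yes e = e
    ... | no ne = ⊥-elim (proj₂ (edge u) (inj₁ (star-u (T⇒≡ (proj₁ (edge u))) ne)))
    Mw : M w ≡ v
    Mw with M w ≟ v | M w ≟ u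
    ... | yes e | _ = e
    ... | no ne | no ne′ = ⊥-elim (proj₂ (edge w) (inj₁ (star-w (T⇒≡ (proj₁ (edge w))) ne ne′)))
    -- The list at `w` does not contain the pair leading to `u`; this case is excluded because `u`
    -- is already matched to `v`.
    ... | no _  | yes e = contradiction (trans (sym Mu) (trans (cong M (sym e)) (MM w))) (adj⇒≢ vw)

  v-start : ∀ {b} → ¬ (v , b) ∈ star
  v-start p with proj₂ (proj₂ (star⇒ p))
  ... | inj₁ v≡u = adj⇒≢ uv (sym v≡u)
  ... | inj₂ (v≡w , _) = adj⇒≢ vw v≡w

  star-not-isolated : ¬ HasIsolatedVertex G star
  star-not-isolated (x , isolated) with x ≟ u | x ≟ w
  ... | yes refl | _ = isolated v (≡⇒T uv , λ { (inj₁ p) → proj₁ (proj₂ (star⇒ p)) refl ; (inj₂ p) → v-start p })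
  ... | no _ | yes refl = isolated v (≡⇒T wv , λ { (inj₁ p) → proj₁ (proj₂ (star⇒ p)) refl ; (inj₂ p) → v-start p })
  ... | no x≢u | no x≢w = let y , y≢u , y≢w , p = other in
        isolated y (≡⇒T (1≤𝟙⇒ p) , λ { (inj₁ q) → start x≢u x≢w q ; (inj₂ q) → start y≢u y≢w q })
    where
    start : ∀ {a b} → a ≢ u → a ≢ w → ¬ (a , b) ∈ star
    start a≢u a≢w p with proj₂ (proj₂ (star⇒ p))
    ... | inj₁ e = a≢u e
    ... | inj₂ (e , _) = a≢w e
    -- Every listed pair starts at `u` or `w`, so an edge avoiding both survives; `x` has one since
    -- its degree is at least four.
    other : ∃[ y ] y ≢ u × y ≢ w × 1 ≤ 𝟙 (adj G x y)
    other = third-term {f = 𝟙 ∘ adj G x} (adj⇒≢ uw)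
      (≤-trans (s≤s (+-mono-≤ (𝟙≤1 (adj G x u)) (𝟙≤1 (adj G x w)))) (≤-trans (n≤1+n 3) (≤-trans r≥4 (≤-reflexive (sym (regular x))))))

  isMp1 : IsMp1 G m
  isMp1 = (star , star-valid , star-length , star-imperfect , star-not-isolated) , λ F _ solution → m≤length F solution

  superMatched : (∀ A → 4 ≤ card A → card A + 4 ≤ N G → 3 * r ≤ ∂ (adj G) A + 5) → ConditionallySuperMatched G
  superMatched ∂-4 = m , isMp1 , isVe , λ F _ size solution →
    let x , y , v , x≢y , leaf-x , leaf-y = two-leaves F solution ∂-4 (≤-reflexive (trans (cong (_+ 3) size) m+3))
    in trivial F solution size x y v x≢y leaf-x leaf-y

-- Any clique contains one when n is at least 3. It supplies both the path attaining `v_e` and the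
-- star that shows the bound on |F| to be sharp.
triangle : ∀ ν k → 2 ≤ ν → let a = dcellAdj k (suc ν) in
  ∃[ u ] ∃[ v ] ∃[ w ] a u v ≡ true × a v w ≡ true × a u w ≡ true
triangle (suc zero)    _ (s≤s ())
triangle (suc (suc ν)) zero _ = zero , suc zero , suc (suc zero) , refl , refl , refl
triangle ν@(suc (suc _)) (suc k) ν≥2 =
  let open DCells ν
      u , v , w , uv , vw , uw = triangle ν k ν≥2
      lift = λ {x} {y} → trans {k = true} (cell-copy k zero x y)
  in vertex {k} zero u , vertex {k} zero v , vertex {k} zero w , lift uv , lift vw , lift uw

theorem26 : (k n : ℕ) → 3 ≤ k → 3 ≤ n →
    IsMp1 (DCell k n) (2 * n + 2 * k ∸ 5)
    × (4 ≤ k → ConditionallySuperMatched (DCell k n))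
theorem26 (suc k) (suc ν) (s≤s 2≤k) (s≤s ν≥2) =
  let open Boundary ν ν≥2
      h , even = pronic-even (t k (suc ν))
      _ , _ , _ , uv , vw , uw = triangle ν (suc k) ν≥2
      open Preclusion (DCell (suc k) (suc ν)) (isoperimetric k 2≤k) h even {2 * suc ν + 2 * suc k ∸ 5} value uv vw uw
  in isMp1 , λ { (s≤s 3≤k) → superMatched (∂-four k 3≤k) }
  where
  double : ∀ ν k → 2 * suc ν + 2 * suc k ≡ 2 + 2 * (ν + suc k)
  double = solve-∀
  value : 2 * suc ν + 2 * suc k ∸ 5 + 3 ≡ 2 * (ν + suc k)
  value = trans (cong (λ a → a ∸ 5 + 3) (double ν k))
    (m∸n+n≡m (≤-trans (s≤s (s≤s (s≤s z≤n))) (*-monoʳ-≤ 2 (+-mono-≤ ν≥2 (s≤s (z≤n {k}))))))
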